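{- (a) There is a function $\varepsilon(n)=o(n)$ such that with probability tending to $1$ as $n\to\infty$, $f^*(2,2,n)+\varepsilon(n)\ge \frac{49}{72}n$. (b) There is a function $\varepsilon(n)=o(n)$ such that with probability tending to $1$ as $n\to\infty$, $f^*(2,2,n)-\varepsilon(n)\le \frac34 n$.
   Context: A tournament is an orientation of a complete graph. An arborescence is an oriented tree with a designated root such that every vertex of the tree is reachable from the root by a directed path in the tree; its depth is the length of a longest directed path in it. An edge-colored arborescence is path-monochromatic if every directed path in it is monochromatic. For a tournament $T$, $f_T(2,2)$ is the largest integer $m$ such that every $2$-edge coloring of $T$ (arbitrary assignment of one of two colors to each edge) contains a path-monochromatic arborescence of depth at most $2$ with at least $m$ vertices. A random tournament $T\sim\mathcal T_n$ is the tournament on $[n]$ where each edge is oriented independently by a fair coin flip, and $f^*(2,2,n)$ denotes the random variable $f_T(2,2)$ for $T\sim\mathcal T_n$. -}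

module Defs where

open import Data.Nat using (ℕ; zero; suc; _+_; _*_; _^_; _≤_)
open import Data.Nat.Combinatorics using (_C_)
open import Data.Bool using (Bool; true; false; not)
open import Data.Fin using (Fin)
open import Data.Fin.Subset using (Subset; _∈_; ∣_∣)
open import Data.Vec using (Vec; lookup)
open import Data.List using (List; length)
open import Data.List.Relation.Unary.All using (All)
open import Data.List.Relation.Unary.Unique.Propositional using (Unique)
open import Data.Product using (Σ; ∃; _×_)
open import Data.Sum using (_⊎_)
open import Relation.Nullary using (¬_)
open import Relation.Binary.PropositionalEquality using (_≡_; _≢_)

Matrix : ℕ → Set
Matrix n = Vec (Vec Bool n) n

entry : {n : ℕ} → Matrix n → Fin n → Fin n → Bool
entry M i j = lookup (lookup M i) j

Arc : {n : ℕ} → Matrix n → Fin n → Fin n → Set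
Arc M i j = entry M i j ≡ true

IsTournament : {n : ℕ} → Matrix n → Set
IsTournament {n} M =
  ((i : Fin n) → entry M i i ≡ false) ×
  ((i j : Fin n) → i ≢ j → entry M i j ≡ not (entry M j i))

-- A 2-edge colouring: colour of arc i → j (only relevant when the arc exists).
Colouring : ℕ → Set
Colouring n = Fin n → Fin n → Fin 2

-- A path-monochromatic arborescence of depth at most 2 in (M , c).
-- The tree is given by its root, vertex set, and the parent map (every
-- non-root vertex of an arborescence has a unique in-arc in the tree).
-- Depth ≤ 2: every non-root vertex is a child or grandchild of the root.
-- Then the only directed paths of length ≥ 2 are
-- parent (parent v) → parent v → v, which must be monochromatic.
record PMArb2 {n : ℕ} (M : Matrix n) (c : Colouring n) : Set where
  field
    root    : Fin n
    verts   : Subset n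
    parent  : Fin n → Fin n
    root∈   : root ∈ verts
    parent∈ : ∀ v → v ∈ verts → v ≢ root → parent v ∈ verts
    parentArc : ∀ v → v ∈ verts → v ≢ root → Arc M (parent v) v
    depth≤2 : ∀ v → v ∈ verts → v ≢ root →
              (parent v ≡ root) ⊎ (parent (parent v) ≡ root)
    mono    : ∀ v → v ∈ verts → v ≢ root → parent v ≢ root →
              c (parent (parent v)) (parent v) ≡ c (parent v) v

-- Every 2-edge colouring of M contains a path-monochromatic
-- arborescence of depth ≤ 2 with at least m vertices.
-- f_T(2,2) is the largest m with Guarantees T m.
Guarantees : {n : ℕ} → Matrix n → ℕ → Set
Guarantees {n} M m = (c : Colouring n) → Σ (PMArb2 M c) (λ A → m ≤ ∣ PMArb2.verts A ∣)

-- Pr_{T ∼ 𝒯_n}[ Q T ] ≤ 1/(k+1): every duplicate-free list of tournaments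
-- on [n] satisfying Q has length ℓ with (k+1)·ℓ ≤ 2^(n choose 2)
-- (the number of tournaments on [n]).
ProbAtMost : (n : ℕ) → (Matrix n → Set) → ℕ → Set
ProbAtMost n Q k =
  (L : List (Matrix n)) → Unique L → All (λ M → IsTournament M × Q M) L →
  suc k * length L ≤ 2 ^ (n C 2)

WithHighProb : ((n : ℕ) → Matrix n → Set) → Set
WithHighProb P =
  (k : ℕ) → ∃ λ N → (n : ℕ) → N ≤ n → ProbAtMost n (λ M → ¬ P n M) k

LittleO : (ℕ → ℕ) → Set
LittleO ε = (k : ℕ) → ∃ λ N → (n : ℕ) → N ≤ n → suc k * ε n ≤ n

-- f_T(2,2) + ε ≥ 49n/72  (f_T ≥ m iff some m' ≥ m is guaranteed)
LowerEvent : (ℕ → ℕ) → (n : ℕ) → Matrix n → Set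
LowerEvent ε n M = ∃ λ m → Guarantees M m × 49 * n ≤ 72 * (m + ε n)

UpperEvent : (ℕ → ℕ) → (n : ℕ) → Matrix n → Set
UpperEvent ε n M = (m : ℕ) → Guarantees M m → 4 * m ≤ 3 * n + 4 * ε n

{-# OPTIONS --safe #-}
module Submission where

-- Upper bound.  Split the vertices into two halves; give one colour to the arcs inside the
-- halves and the other to the arcs between them.  A monochromatic path of length two ends in
-- the half in which it starts, so in the other half an arborescence of depth 2 contains only
-- out-neighbours of its root.  By a fourth moment bound there are at most n/4 + o(n) of those.
--
-- Lower bound.  Say that v misses w if no monochromatic path of length at most 2 leads from v
-- to w; then w → v and every path v → x → w is bichromatic.  With two colours, the three arcs
-- of a cyclic triangle cannot all join a missed vertex to a vertex missing it.  Hence a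
-- triangle v → x → w → v has at most one corner v such that x misses v and v misses w.  If
-- every vertex missed at least βn vertices, quasirandomness would give about β²n³/2 such
-- corners, but there are only about n³/24 cyclic triangles; so β² ≤ 1/12, whereas 5/16 is
-- larger than 1/√12 and smaller than 1 − 49/72.  The discrepancy between any two vertex sets
-- is controlled, by Cauchy–Schwarz, by the signed count of 4-cycles, which is O(n³) on average.

open import Defs
open import Algebra.Properties.AbelianGroup using (∙-cancelˡ)
import Algebra.Properties.Semiring.Sum as SemiringSum
open import Data.Bool using (Bool; true; false; not; if_then_else_; _∧_; _∨_; _xor_)
open import Data.Bool.Properties as Bool using (not-involutive; ∨-comm; ∧-comm; xor-same; ¬-not)
open import Data.Empty using (⊥; ⊥-elim)
open import Data.Fin using (Fin; zero; suc)
open import Data.Fin.Properties using (_≟_; any?)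
open import Data.Fin.Subset as Subset using (Subset)
open import Data.Integer using (ℤ; +_; -[1+_]; 0ℤ; 1ℤ; _+_; _*_; _-_; -_; _≤_; _<_; +≤+; -≤+; ∣_∣; positive)
import Data.Integer.Properties as ℤ
open import Data.Integer.Solver using (module +-*-Solver)
open import Data.List as List using (List; []; _∷_; _++_; length; cartesianProductWith)
open import Data.List.Membership.Propositional using (_∈_)
open import Data.List.Membership.Propositional.Properties
  using (∈-∃++; ∈-map⁻; ∈-cartesianProductWith⁺; ∈-cartesianProductWith⁻)
open import Data.List.Properties using (length-map; length-++; ++-identityʳ)
open import Data.List.Relation.Binary.Permutation.Propositional
  using (_↭_; ↭-trans; ↭-refl; ↭-reflexive; refl; prep; swap; trans)
open import Data.List.Relation.Binary.Permutation.Propositional.Properties using (shift; ∈-resp-↭; ↭-length)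
open import Data.List.Relation.Unary.All as All using (All; []; _∷_)
open import Data.List.Relation.Unary.AllPairs using ([]; _∷_)
open import Data.List.Relation.Unary.Any using (here; there)
open import Data.List.Relation.Unary.Unique.Propositional using (Unique)
import Data.List.Relation.Unary.Unique.Propositional.Properties as Unique
open import Data.Nat as ℕ using (ℕ; zero; suc)
open import Data.Nat.Combinatorics using (_C_; nCk+nC[k+1]≡[n+1]C[k+1]; nC1≡n)
open import Data.Nat.DivMod using (_/_; _%_; m/n*n≤m; m≡m%n+[m/n]*n; m%n<n)
import Data.Nat.Properties as ℕ
import Data.Nat.Solver as ℕSolver
open import Data.Product using (Σ; ∃; _×_; _,_; proj₁; proj₂)
open import Data.Sum using (_⊎_; inj₁; inj₂)
open import Data.Vec as Vec using (Vec; []; _∷_; lookup; tabulate)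
open import Data.Vec.Properties
  using ( lookup∘tabulate; tabulate∘lookup; tabulate-cong; ∷-injectiveˡ; ∷-injectiveʳ; lookup-zipWith
        ; []=⇒lookup; lookup⇒[]=)
open import Function using (_∘_)
open import Relation.Binary.PropositionalEquality as ≡
  using (_≡_; _≢_; refl; sym; cong; cong₂; subst; subst₂; module ≡-Reasoning)
open import Relation.Nullary using (¬_; Dec; yes; no; does)
open import Relation.Nullary.Decidable using (dec-true; _×-dec_; _⊎-dec_)
open +-*-Solver using (solve; _:+_; _:*_; _:-_; :-_; _:=_; con)
open ℕSolver.+-*-Solver using ()
  renaming (solve to ℕ-solve; _:*_ to _⊗_; _:=_ to _⊜_; con to ℕ-con; _:^_ to _↑_)

private
  module Sum = SemiringSum ℤ.+-*-semiring

private variable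
  n : ℕ
  A : Set

-- Integers and finite sums

≤-by : ∀ {i j} d → 0ℤ ≤ d → j ≡ i + d → i ≤ j
≤-by {i} d 0≤d refl = subst (_≤ i + d) (ℤ.+-identityʳ i) (ℤ.+-monoʳ-≤ i 0≤d)

0≤+ : ∀ {i j} → 0ℤ ≤ i → 0ℤ ≤ j → 0ℤ ≤ i + j
0≤+ = ℤ.+-mono-≤

0≤* : ∀ {i j} → 0ℤ ≤ i → 0ℤ ≤ j → 0ℤ ≤ i * j
0≤* {+ m} {+ k} _ _ = subst (0ℤ ≤_) (ℤ.pos-* m k) (+≤+ ℕ.z≤n)

0≤-square : ∀ i → 0ℤ ≤ i * i
0≤-square (+ m)    = 0≤* {+ m} {+ m} (+≤+ ℕ.z≤n) (+≤+ ℕ.z≤n)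
0≤-square -[1+ m ] = +≤+ ℕ.z≤n

nonneg-mono : ∀ {i j k} → 0ℤ ≤ i → j ≤ k → i * j ≤ i * k
nonneg-mono {+ i} _ j≤k = ℤ.*-monoˡ-≤-nonNeg (+ i) j≤k

-- Such an `f` is 0, 1 or -1, so its square is 0 or 1. This is how the weights disappear from the
-- discrepancy bounds.
∣f∣≤1⇒square≤ : ∀ f h → ∣ f ∣ ℕ.≤ 1 → (f * h) * (f * h) ≤ h * h
∣f∣≤1⇒square≤ (+ 0)       h _ = 0≤-square h
∣f∣≤1⇒square≤ (+ 1)       h _ = ℤ.≤-reflexive (cong₂ _*_ (ℤ.*-identityˡ h) (ℤ.*-identityˡ h))
∣f∣≤1⇒square≤ -[1+ 0 ]    h _ = ℤ.≤-reflexive (solve 1 (λ h → (con -[1+ 0 ] :* h) :*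
  (con -[1+ 0 ] :* h) := h :* h) refl h)
∣f∣≤1⇒square≤ (+ suc (suc _)) h (ℕ.s≤s ())
∣f∣≤1⇒square≤ -[1+ suc _ ]    h (ℕ.s≤s ())

square-mono : ∀ {i j} → 0ℤ ≤ i → i ≤ j → i * i ≤ j * j
square-mono {i} {j} 0≤i i≤j = ≤-by _ (0≤+ (0≤* 0≤i (ℤ.i≤j⇒0≤j-i i≤j)) (0≤* (ℤ.≤-trans 0≤i i≤j) (ℤ.i≤j⇒0≤j-i i≤j)))
  (solve 2 (λ i j → j :* j := i :* i :+ (i :* (j :- i) :+ j :* (j :- i))) refl i j)

-- If j < i then i ≥ j + 1 > 0, so i² ≥ (j + 1)² > j². The sign of `i` is free, so a bound on a
-- square bounds both a number and its negative.
square-cancel : ∀ {i j} → 0ℤ ≤ j → i * i ≤ j * j → i ≤ j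
square-cancel {i} {j} 0≤j i²≤j² = ℤ.≮⇒≥ λ j<i → ℤ.<⇒≱ {j * j} {j * j + 1ℤ}
  (ℤ.suc[i]≤j⇒i<j (ℤ.≤-reflexive (ℤ.+-comm 1ℤ (j * j)))) (begin
  j * j + 1ℤ
    ≤⟨ ≤-by (j + j) (0≤+ 0≤j 0≤j) (solve 1 (λ j → (con 1ℤ :+ j) :* (con 1ℤ :+ j) := j :* j :+ con 1ℤ :+
        (j :+ j)) refl j) ⟩
  (1ℤ + j) * (1ℤ + j)  ≤⟨ square-mono (0≤+ (+≤+ ℕ.z≤n) 0≤j) (ℤ.i<j⇒suc[i]≤j j<i) ⟩
  i * i                ≤⟨ i²≤j² ⟩
  j * j                ∎)
  where open ℤ.≤-Reasoning

fourth-power-mono : ∀ {i j} → 0ℤ ≤ i → i ≤ j → i * (i * (i * i)) ≤ j * (j * (j * j))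
fourth-power-mono {i} {j} 0≤i i≤j = subst₂ _≤_ (ℤ.*-assoc i i (i * i)) (ℤ.*-assoc j j (j * j))
  (square-mono (0≤-square i) (square-mono 0≤i i≤j))

opaque
  ∑ : (Fin n → ℤ) → ℤ
  ∑ = Sum.sum

  ∑-empty : (f : Fin 0 → ℤ) → ∑ f ≡ 0ℤ
  ∑-empty f = refl

  ∑-suc : (f : Fin (suc n) → ℤ) → ∑ f ≡ f zero + ∑ (f ∘ suc)
  ∑-suc f = refl

  ∑-cong : {f g : Fin n → ℤ} → (∀ i → f i ≡ g i) → ∑ f ≡ ∑ g
  ∑-cong = Sum.sum-cong-≗

  ∑-+ : (f g : Fin n → ℤ) → ∑ (λ i → f i + g i) ≡ ∑ f + ∑ g
  ∑-+ = Sum.∑-distrib-+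

  ∑-swap : ∀ {m} (f : Fin m → Fin n → ℤ) → ∑ (λ i → ∑ λ j → f i j) ≡ ∑ (λ j → ∑ λ i → f i j)
  ∑-swap = Sum.∑-comm

  *-∑ : ∀ x (f : Fin n → ℤ) → x * ∑ f ≡ ∑ λ i → x * f i
  *-∑ = Sum.*-distribˡ-sum

  ∑-* : ∀ (f : Fin n → ℤ) x → ∑ f * x ≡ ∑ λ i → f i * x
  ∑-* f x = Sum.*-distribʳ-sum x f

  ∑-mono : {f g : Fin n → ℤ} → (∀ i → f i ≤ g i) → ∑ f ≤ ∑ g
  ∑-mono {zero}  f≤g = ℤ.≤-refl
  ∑-mono {suc n} f≤g = ℤ.+-mono-≤ (f≤g zero) (∑-mono (f≤g ∘ suc))

  ∑-const : ∀ n x → ∑ {n} (λ _ → x) ≡ + n * x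
  ∑-const zero    x = sym (ℤ.*-zeroˡ x)
  ∑-const (suc n) x = ≡.trans (cong (_+_ x) (∑-const n x)) (sym (ℤ.suc-* (+ n) x))

∑-nonneg : {f : Fin n → ℤ} → (∀ i → 0ℤ ≤ f i) → 0ℤ ≤ ∑ f
∑-nonneg {n} 0≤f = ℤ.≤-trans (ℤ.≤-reflexive (sym (≡.trans (∑-const n 0ℤ) (ℤ.*-zeroʳ (+ n))))) (∑-mono 0≤f)

term≤∑ : {f : Fin n → ℤ} → (∀ i → 0ℤ ≤ f i) → ∀ i → f i ≤ ∑ f
term≤∑ {f = f} 0≤f zero    = ≤-by (∑ (f ∘ suc)) (∑-nonneg (0≤f ∘ suc)) (∑-suc f)
term≤∑ {f = f} 0≤f (suc i) =
  ℤ.≤-trans (term≤∑ (0≤f ∘ suc) i) (≤-by (f zero) (0≤f zero) (≡.trans (∑-suc f) (ℤ.+-comm (f zero) _)))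

∑-bound : {f : Fin n → ℤ} {x : ℤ} → (∀ i → f i ≤ x) → ∑ f ≤ + n * x
∑-bound {n} {x = x} f≤x = ℤ.≤-trans (∑-mono f≤x) (ℤ.≤-reflexive (∑-const n x))

∑² : (Fin n → Fin n → ℤ) → ℤ
∑² f = ∑ λ i → ∑ λ j → f i j

∑-product : (f g : Fin n → ℤ) → ∑ f * ∑ g ≡ ∑² λ i j → f i * g j
∑-product f g = ≡.trans (∑-* f (∑ g)) (∑-cong λ i → *-∑ (f i) g)

-- Cauchy-Schwarz against the constant 1: the squares (p i - p j)², summed over all i and j, give
-- 2(n·Q - S²).
∑-square≤ : (p : Fin n → ℤ) → ∑ p * ∑ p ≤ + n * ∑ λ i → p i * p i
∑-square≤ {n} p = half (≤-by _ (∑-nonneg λ i → ∑-nonneg λ j → 0≤-square (p i - p j)) (sym expand))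
  where
  open ≡-Reasoning
  S = ∑ p
  Q = ∑ λ i → p i * p i
  half : S * S + S * S ≤ + n * Q + + n * Q → S * S ≤ + n * Q
  half h = ℤ.*-cancelˡ-≤-pos _ _ (+ 2) (subst₂ _≤_ (double (S * S)) (double (+ n * Q)) h)
    where
    double : ∀ x → x + x ≡ + 2 * x
    double = solve 1 (λ x → x :+ x := con (+ 2) :* x) refl
  row : ∀ i → ∑ (λ j → (p i - p j) * (p i - p j)) ≡ + n * (p i * p i) + ((- (S + S)) * p i + Q)
  row i = begin
    ∑ (λ j → (p i - p j) * (p i - p j))
      ≡⟨ ∑-cong (λ j → solve 2 (λ p q → (p :- q) :* (p :- q) := p :* p :+ ((:- (p :+ p)) :* q :+ q :* q)) refl
          (p i) (p j)) ⟩
    ∑ (λ j → p i * p i + ((- (p i + p i)) * p j + p j * p j))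
      ≡⟨ ∑-+ _ _ ⟩
    ∑ {n} (λ _ → p i * p i) + ∑ (λ j → (- (p i + p i)) * p j + p j * p j)
      ≡⟨ cong₂ _+_ (∑-const n _) (∑-+ _ _) ⟩
    + n * (p i * p i) + (∑ (λ j → (- (p i + p i)) * p j) + Q)
      ≡⟨ cong (λ z → + n * (p i * p i) + (z + Q)) (≡.trans (sym (*-∑ (- (p i + p i)) p))
           (solve 2 (λ p S → (:- (p :+ p)) :* S := (:- (S :+ S)) :* p) refl (p i) S)) ⟩
    + n * (p i * p i) + ((- (S + S)) * p i + Q) ∎
  expand : S * S + S * S + ∑² (λ i j → (p i - p j) * (p i - p j)) ≡ + n * Q + + n * Q
  expand = begin
    S * S + S * S + ∑² (λ i j → (p i - p j) * (p i - p j))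
      ≡⟨ cong (_+_ (S * S + S * S)) (≡.trans (∑-cong row)
          (≡.trans (∑-+ _ _) (cong (_+_ (∑ (λ i → + n * (p i * p i)))) (∑-+ _ _)))) ⟩
    S * S + S * S + (∑ (λ i → + n * (p i * p i)) + (∑ (λ i → (- (S + S)) * p i) + ∑ {n} (λ _ → Q)))
      ≡⟨ cong (_+_ (S * S + S * S)) (cong₂ _+_ (sym (*-∑ (+ n) _))
          (cong₂ _+_ (sym (*-∑ (- (S + S)) p)) (∑-const n Q))) ⟩
    S * S + S * S + (+ n * Q + ((- (S + S)) * S + + n * Q))
      ≡⟨ solve 3 (λ n S Q → S :* S :+ S :* S :+ (n :* Q :+ ((:- (S :+ S)) :* S :+ n :* Q)) := n :* Q :+ n :* Q)
          refl (+ n) S Q ⟩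
    + n * Q + + n * Q ∎

-- The uniform distribution on tournaments

∑ᴸ : (A → ℤ) → List A → ℤ
∑ᴸ f []       = 0ℤ
∑ᴸ f (x ∷ xs) = f x + ∑ᴸ f xs

∑ᴸ-++ : ∀ (f : A → ℤ) xs ys → ∑ᴸ f (xs ++ ys) ≡ ∑ᴸ f xs + ∑ᴸ f ys
∑ᴸ-++ f []       ys = sym (ℤ.+-identityˡ _)
∑ᴸ-++ f (x ∷ xs) ys = ≡.trans (cong (_+_ (f x)) (∑ᴸ-++ f xs ys)) (sym (ℤ.+-assoc (f x) _ _))

∑ᴸ-↭ : ∀ (f : A → ℤ) {xs ys} → xs ↭ ys → ∑ᴸ f xs ≡ ∑ᴸ f ys
∑ᴸ-↭ f refl          = refl
∑ᴸ-↭ f (prep x p)    = cong (_+_ (f x)) (∑ᴸ-↭ f p)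
∑ᴸ-↭ f (swap x y p)  = ≡.trans (cong (λ z → f x + (f y + z)) (∑ᴸ-↭ f p))
  (solve 3 (λ a b c → a :+ (b :+ c) := b :+ (a :+ c)) refl (f x) (f y) _)
∑ᴸ-↭ f (trans p q)   = ≡.trans (∑ᴸ-↭ f p) (∑ᴸ-↭ f q)

∑ᴸ-map : ∀ (f : A → ℤ) (g : A → A) xs → ∑ᴸ f (List.map g xs) ≡ ∑ᴸ (f ∘ g) xs
∑ᴸ-map f g []       = refl
∑ᴸ-map f g (x ∷ xs) = cong (_+_ (f (g x))) (∑ᴸ-map f g xs)

∑ᴸ-cong : ∀ {f g : A → ℤ} → (∀ x → f x ≡ g x) → ∀ xs → ∑ᴸ f xs ≡ ∑ᴸ g xs
∑ᴸ-cong f≡g []       = refl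
∑ᴸ-cong f≡g (x ∷ xs) = cong₂ _+_ (f≡g x) (∑ᴸ-cong f≡g xs)

∑ᴸ-neg : ∀ (f : A → ℤ) xs → ∑ᴸ (λ x → - f x) xs ≡ - ∑ᴸ f xs
∑ᴸ-neg f []       = refl
∑ᴸ-neg f (x ∷ xs) = ≡.trans (cong (_+_ (- f x)) (∑ᴸ-neg f xs)) (sym (ℤ.neg-distrib-+ (f x) _))

∑ᴸ-∑ : ∀ (f : Fin n → A → ℤ) xs → ∑ᴸ (λ x → ∑ λ i → f i x) xs ≡ ∑ λ i → ∑ᴸ (f i) xs
∑ᴸ-∑ {n} f []       = sym (≡.trans (∑-const n 0ℤ) (ℤ.*-zeroʳ (+ n)))
∑ᴸ-∑     f (x ∷ xs) = ≡.trans (cong (_+_ (∑ λ i → f i x)) (∑ᴸ-∑ f xs)) (sym (∑-+ _ _))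

∑ᴸ-* : ∀ c (f : A → ℤ) xs → ∑ᴸ (λ x → c * f x) xs ≡ c * ∑ᴸ f xs
∑ᴸ-* c f []       = sym (ℤ.*-zeroʳ c)
∑ᴸ-* c f (x ∷ xs) = ≡.trans (cong (_+_ (c * f x)) (∑ᴸ-* c f xs)) (sym (ℤ.*-distribˡ-+ c (f x) _))

∑ᴸ-nonneg : ∀ {f : A → ℤ} → (∀ x → 0ℤ ≤ f x) → ∀ xs → 0ℤ ≤ ∑ᴸ f xs
∑ᴸ-nonneg 0≤f []       = ℤ.≤-refl
∑ᴸ-nonneg 0≤f (x ∷ xs) = 0≤+ (0≤f x) (∑ᴸ-nonneg 0≤f xs)

∑ᴸ-≤ : ∀ {f : A → ℤ} {b} → (∀ x → f x ≤ b) → ∀ xs → ∑ᴸ f xs ≤ + length xs * b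
∑ᴸ-≤ {b = b} f≤b []       = ℤ.≤-reflexive (sym (ℤ.*-zeroˡ b))
∑ᴸ-≤ {b = b} f≤b (x ∷ xs) = ℤ.≤-trans (ℤ.+-mono-≤ (f≤b x) (∑ᴸ-≤ f≤b xs))
  (ℤ.≤-reflexive (sym (ℤ.suc-* (+ length xs) b)))

∑ᴸ-≥ : ∀ {f : A → ℤ} {b xs} → All (λ x → b ≤ f x) xs → + length xs * b ≤ ∑ᴸ f xs
∑ᴸ-≥ {b = b} []       = ℤ.≤-reflexive (ℤ.*-zeroˡ b)
∑ᴸ-≥ {b = b} {x ∷ xs} (b≤ ∷ bs≤) = ℤ.≤-trans (ℤ.≤-reflexive (ℤ.suc-* (+ length xs) b)) (ℤ.+-mono-≤ b≤ (∑ᴸ-≥ bs≤))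

∈-tail : ∀ {x y : A} {xs} → y ∈ x ∷ xs → x ≢ y → y ∈ xs
∈-tail (here refl) x≢y = ⊥-elim (x≢y refl)
∈-tail (there y∈)  _   = y∈

-- Each head of `xs` is located in `ys` and removed there. As `xs` has no duplicates, the later
-- elements survive the removal; `zs` is what remains at the end.
unique-⊆⇒↭ : ∀ {xs ys : List A} → Unique xs → (∀ {x} → x ∈ xs → x ∈ ys) → ∃ λ zs → ys ↭ xs ++ zs
unique-⊆⇒↭ {xs = []}     {ys} _          _  = ys , ↭-refl
unique-⊆⇒↭ {xs = x ∷ xs} {ys} (x∉ ∷ uxs) xs⊆ys
  with as , bs , refl ← ∈-∃++ (xs⊆ys (here refl))
  with zs , p ← unique-⊆⇒↭ {xs = xs} {as ++ bs} uxs (λ y∈ → ∈-tail (∈-resp-↭ (shift x as bs) (xs⊆ys (there y∈)))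
      (All.lookup x∉ y∈))
  = zs , ↭-trans (shift x as bs) (prep x p)
unique-⊆-length⇒↭ : ∀ {xs ys : List A} → Unique xs → (∀ {x} → x ∈ xs → x ∈ ys) → length xs ≡ length ys → ys ↭ xs
unique-⊆-length⇒↭ {xs = xs} u xs⊆ys len with unique-⊆⇒↭ u xs⊆ys
... | [] , p     = ↭-trans p (↭-reflexive (++-identityʳ xs))
... | z ∷ zs , p = ⊥-elim (ℕ.m≢1+m+n (length xs)
  (≡.trans len (≡.trans (↭-length p) (≡.trans (length-++ xs) (ℕ.+-suc (length xs) (length zs))))))

∑ᴸ-⊆ : ∀ {f : A → ℤ} {xs ys} → (∀ x → 0ℤ ≤ f x) → Unique xs → (∀ {x} → x ∈ xs → x ∈ ys) → ∑ᴸ f xs ≤ ∑ᴸ f ys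
∑ᴸ-⊆ {f = f} {xs} 0≤f u xs⊆ys with zs , p ← unique-⊆⇒↭ u xs⊆ys =
  ≤-by (∑ᴸ f zs) (∑ᴸ-nonneg 0≤f zs) (≡.trans (∑ᴸ-↭ f p) (∑ᴸ-++ f xs zs))

-- The list of all tournaments

matrix-ext : {M N : Matrix n} → (∀ i j → entry M i j ≡ entry N i j) → M ≡ N
matrix-ext {M = M} {N} eq = lookup-ext λ i → lookup-ext (eq i)
  where
  lookup-ext : ∀ {A : Set} {m} {xs ys : Vec A m} → (∀ i → lookup xs i ≡ lookup ys i) → xs ≡ ys
  lookup-ext {xs = xs} {ys} e = ≡.trans (sym (tabulate∘lookup xs)) (≡.trans (tabulate-cong e) (tabulate∘lookup ys))

length-cartesianProductWith : ∀ {A B C : Set} (f : A → B → C) xs ys → length (cartesianProductWith f xs ys)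
  ≡ length xs ℕ.* length ys
length-cartesianProductWith f []       ys = refl
length-cartesianProductWith f (x ∷ xs) ys = ≡.trans (length-++ (List.map (f x) ys))
  (cong₂ ℕ._+_ (length-map (f x) ys) (length-cartesianProductWith f xs ys))

bitVectors : ∀ n → List (Vec Bool n)
bitVectors zero    = [] ∷ []
bitVectors (suc n) = cartesianProductWith _∷_ (true ∷ false ∷ []) (bitVectors n)

∈-bitVectors : (v : Vec Bool n) → v ∈ bitVectors n
∈-bitVectors []       = here refl
∈-bitVectors (b ∷ v) = ∈-cartesianProductWith⁺ _∷_ (∈-bits b) (∈-bitVectors v)
  where
  ∈-bits : ∀ b → b ∈ true ∷ false ∷ []
  ∈-bits true  = here refl
  ∈-bits false = there (here refl)

bitVectors-unique : ∀ n → Unique (bitVectors n)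
bitVectors-unique zero    = [] ∷ []
bitVectors-unique (suc n) = Unique.cartesianProductWith⁺ _∷_ (λ e → ∷-injectiveˡ e , ∷-injectiveʳ e)
  (((λ ()) ∷ []) ∷ [] ∷ []) (bitVectors-unique n)

length-bitVectors : ∀ n → length (bitVectors n) ≡ 2 ℕ.^ n
length-bitVectors zero    = refl
length-bitVectors (suc n) = ≡.trans (length-cartesianProductWith _∷_ (true ∷ false ∷ []) (bitVectors n))
  (cong (2 ℕ.*_) (length-bitVectors n))

addVertex : Vec Bool n → Matrix n → Matrix (suc n)
addVertex r M = (false ∷ r) ∷ Vec.zipWith (λ b row → not b ∷ row) r M

tournaments : ∀ n → List (Matrix n)
tournaments zero    = [] ∷ []
tournaments (suc n) = cartesianProductWith addVertex (bitVectors n) (tournaments n)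

-- A new vertex multiplies the number by 2^n, and Pascal's rule with n C 1 = n updates the exponent.
-- This matches the denominator in `ProbAtMost`.
length-tournaments : ∀ n → length (tournaments n) ≡ 2 ℕ.^ (n C 2)
length-tournaments zero    = refl
length-tournaments (suc n) = begin
  length (tournaments (suc n))
    ≡⟨ length-cartesianProductWith addVertex (bitVectors n) (tournaments n) ⟩
  length (bitVectors n) ℕ.* length (tournaments n)   ≡⟨ cong₂ ℕ._*_ (length-bitVectors n) (length-tournaments n) ⟩
  2 ℕ.^ n ℕ.* 2 ℕ.^ (n C 2)                          ≡⟨ ℕ.^-distribˡ-+-* 2 n (n C 2) ⟨
  2 ℕ.^ (n ℕ.+ n C 2)                                ≡⟨ cong (λ k → 2 ℕ.^ (k ℕ.+ n C 2)) (nC1≡n n) ⟨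
  2 ℕ.^ (n C 1 ℕ.+ n C 2)                            ≡⟨ cong (2 ℕ.^_) (nCk+nC[k+1]≡[n+1]C[k+1] n 1) ⟩
  2 ℕ.^ (suc n C 2)                                  ∎
  where open ≡-Reasoning

addVertex-injective : {r q : Vec Bool n} {M N : Matrix n} → addVertex r M ≡ addVertex q N → r ≡ q × M ≡ N
addVertex-injective {r = r} {q} {M} {N} e = ∷-injectiveʳ (∷-injectiveˡ e) , ≡.trans (sym (tails r M))
  (≡.trans (cong (Vec.map Vec.tail) (∷-injectiveʳ e)) (tails q N))
  where
  tails : ∀ {k m} (r : Vec Bool k) (M : Vec (Vec Bool m) k) → Vec.map Vec.tail
      (Vec.zipWith (λ b row → not b ∷ row) r M) ≡ M
  tails []       []       = refl
  tails (b ∷ r) (v ∷ M) = cong (v ∷_) (tails r M)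

tournaments-unique : ∀ n → Unique (tournaments n)
tournaments-unique zero    = [] ∷ []
tournaments-unique (suc n) = Unique.cartesianProductWith⁺ addVertex addVertex-injective (bitVectors-unique n)
  (tournaments-unique n)

addVertex-tournament : (r : Vec Bool n) {M : Matrix n} → IsTournament M → IsTournament (addVertex r M)
addVertex-tournament r {M} (irr , anti) = irr′ , anti′
  where
  row : ∀ i → lookup (Vec.zipWith (λ b row → not b ∷ row) r M) i ≡ not (lookup r i) ∷ lookup M i
  row i = lookup-zipWith _ i r M
  irr′ : ∀ i → entry (addVertex r M) i i ≡ false
  irr′ zero    = refl
  irr′ (suc i) = ≡.trans (cong (λ v → lookup v (suc i)) (row i)) (irr i)
  anti′ : ∀ i j → i ≢ j → entry (addVertex r M) i j ≡ not (entry (addVertex r M) j i)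
  anti′ zero    zero    i≢j = ⊥-elim (i≢j refl)
  anti′ zero    (suc j) _   = ≡.trans (sym (not-involutive _)) (sym (cong (λ v → not (lookup v zero)) (row j)))
  anti′ (suc i) zero    _   = cong (λ v → lookup v zero) (row i)
  anti′ (suc i) (suc j) i≢j = ≡.trans (cong (λ v → lookup v (suc j)) (row i))
    (≡.trans (anti i j (i≢j ∘ cong suc)) (sym (cong (λ v → not (lookup v (suc i))) (row j))))

tournament⇐∈ : ∀ n {M : Matrix n} → M ∈ tournaments n → IsTournament M
tournament⇐∈ zero    _ = (λ ()) , λ ()
tournament⇐∈ (suc n) M∈
  with r , N , _ , N∈ , refl ← ∈-cartesianProductWith⁻ addVertex (bitVectors n) (tournaments n) M∈
  = addVertex-tournament r (tournament⇐∈ n N∈)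

tournament⇒∈ : ∀ n {M : Matrix n} → IsTournament M → M ∈ tournaments n
tournament⇒∈ zero    {[]}           _            = here refl
tournament⇒∈ (suc n) {(b ∷ r) ∷ M} (irr , anti) =
  subst (_∈ tournaments (suc n)) (sym M≡) (∈-cartesianProductWith⁺ addVertex (∈-bitVectors r)
      (tournament⇒∈ n sub-tournament))
  where
  -- Delete the first vertex; antisymmetry recovers its column from its row `r`.
  N : Matrix n
  N = tabulate λ i → tabulate λ j → lookup (lookup M i) (suc j)
  N≡ : ∀ i j → entry N i j ≡ lookup (lookup M i) (suc j)
  N≡ i j = ≡.trans (cong (λ v → lookup v j) (lookup∘tabulate _ i)) (lookup∘tabulate _ j)
  sub-tournament : IsTournament N
  sub-tournament = (λ i → ≡.trans (N≡ i i) (irr (suc i)))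
    , λ i j i≢j → ≡.trans (N≡ i j) (≡.trans (anti (suc i) (suc j) (i≢j ∘ λ { refl → refl }))
        (sym (cong not (N≡ j i))))
  M≡ : (b ∷ r) ∷ M ≡ addVertex r N
  M≡ = matrix-ext λ
    { zero    zero    → irr zero
    ; zero    (suc j) → refl
    ; (suc i) zero    → ≡.trans (anti (suc i) zero λ ()) (sym (cong (λ v → lookup v zero) (lookup-zipWith _ i r N)))
    ; (suc i) (suc j) → ≡.trans (sym (N≡ i j)) (sym (cong (λ v → lookup v (suc j)) (lookup-zipWith _ i r N)))
    }

-- Reversing a single edge

edge? : (x y i j : Fin n) → Bool
edge? x y i j = (does (i ≟ x) ∧ does (j ≟ y)) ∨ (does (i ≟ y) ∧ does (j ≟ x))

flipIf : Bool → Bool → Bool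
flipIf b c = if b then not c else c

flipEdge : (x y : Fin n) → Matrix n → Matrix n
flipEdge x y M = tabulate λ i → tabulate λ j → flipIf (edge? x y i j) (entry M i j)

entry-flipEdge : ∀ (x y : Fin n) M i j → entry (flipEdge x y M) i j ≡ flipIf (edge? x y i j) (entry M i j)
entry-flipEdge x y M i j = ≡.trans (cong (λ v → lookup v j) (lookup∘tabulate _ i)) (lookup∘tabulate _ j)

edge?-sym : ∀ (x y : Fin n) i j → edge? x y i j ≡ edge? x y j i
edge?-sym x y i j = ≡.trans (∨-comm (does (i ≟ x) ∧ does (j ≟ y)) _)
  (cong₂ _∨_ (∧-comm (does (i ≟ y)) _) (∧-comm (does (i ≟ x)) _))

flipEdge-tournament : ∀ {x y : Fin n} → x ≢ y → ∀ {M} → IsTournament M → IsTournament (flipEdge x y M)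
flipEdge-tournament {x = x} {y} x≢y {M} (irr , anti) = irr′ , anti′
  where
  off-diagonal : ∀ i → edge? x y i i ≡ false
  off-diagonal i with i ≟ x | i ≟ y
  ... | yes refl | yes refl = ⊥-elim (x≢y refl)
  ... | yes _    | no _     = refl
  ... | no _     | yes _    = refl
  ... | no _     | no _     = refl
  flipIf-not : ∀ b c → flipIf b (not c) ≡ not (flipIf b c)
  flipIf-not true  c = refl
  flipIf-not false c = refl
  irr′ : ∀ i → entry (flipEdge x y M) i i ≡ false
  irr′ i = ≡.trans (entry-flipEdge x y M i i) (≡.trans (cong (λ b → flipIf b (entry M i i)) (off-diagonal i)) (irr i))
  anti′ : ∀ i j → i ≢ j → entry (flipEdge x y M) i j ≡ not (entry (flipEdge x y M) j i)
  anti′ i j i≢j = begin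
    entry (flipEdge x y M) i j                   ≡⟨ entry-flipEdge x y M i j ⟩
    flipIf (edge? x y i j) (entry M i j)         ≡⟨ cong₂ flipIf (edge?-sym x y i j) (anti i j i≢j) ⟩
    flipIf (edge? x y j i) (not (entry M j i))   ≡⟨ flipIf-not (edge? x y j i) (entry M j i) ⟩
    not (flipIf (edge? x y j i) (entry M j i))   ≡⟨ cong not (entry-flipEdge x y M j i) ⟨
    not (entry (flipEdge x y M) j i)             ∎
    where open ≡-Reasoning

flipEdge-injective : ∀ (x y : Fin n) {M N} → flipEdge x y M ≡ flipEdge x y N → M ≡ N
flipEdge-injective x y {M} {N} e = matrix-ext λ i j → flipIf-injective (edge? x y i j)
  (≡.trans (sym (entry-flipEdge x y M i j)) (≡.trans (cong (λ L → entry L i j) e) (entry-flipEdge x y N i j)))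
  where
  flipIf-injective : ∀ b {c d} → flipIf b c ≡ flipIf b d → c ≡ d
  flipIf-injective true  {c} {d} e = ≡.trans (sym (not-involutive c)) (≡.trans (cong not e) (not-involutive d))
  flipIf-injective false e = e

-- An injective map from a finite duplicate-free list into itself is a permutation. Reversing an
-- edge thus preserves the uniform distribution, and this symmetry takes the place of independence
-- of the edges.
flipEdge-permutes : ∀ {x y : Fin n} → x ≢ y → tournaments n ↭ List.map (flipEdge x y) (tournaments n)
flipEdge-permutes {n} {x} {y} x≢y =
  unique-⊆-length⇒↭ (Unique.map⁺ (flipEdge-injective x y) (tournaments-unique n)) stable
      (length-map (flipEdge x y) (tournaments n))
  where
  stable : ∀ {M} → M ∈ List.map (flipEdge x y) (tournaments n) → M ∈ tournaments n
  stable M∈ with N , N∈ , refl ← ∈-map⁻ (flipEdge x y) M∈ = tournament⇒∈ n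
      (flipEdge-tournament x≢y {N} (tournament⇐∈ n N∈))

⟦_⟧ : Bool → ℤ
⟦ true ⟧  = 1ℤ
⟦ false ⟧ = 0ℤ

arc : Matrix n → Fin n → Fin n → ℤ
arc M i j = ⟦ entry M i j ⟧

-- The sign of the pair {i , j} seen from i; under a uniformly random tournament
-- the signs of distinct pairs are independent and of mean zero.
sign : Matrix n → Fin n → Fin n → ℤ
sign M i j = arc M i j - arc M j i

sign-diagonal : ∀ (M : Matrix n) i → sign M i i ≡ 0ℤ
sign-diagonal M i = ℤ.+-inverseʳ (arc M i i)

module _ (M : Matrix n) (x y : Fin n) where
  private
    arc-flip : ∀ i j → arc (flipEdge x y M) i j ≡ ⟦ flipIf (edge? x y i j) (entry M i j) ⟧
    arc-flip i j = cong ⟦_⟧ (entry-flipEdge x y M i j)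

    edge?-hit : edge? x y x y ≡ true
    edge?-hit with x ≟ x | y ≟ y
    ... | yes _   | yes _   = refl
    ... | no x≢x | _       = ⊥-elim (x≢x refl)
    ... | yes _   | no y≢y = ⊥-elim (y≢y refl)

    edge?-miss : ∀ i j → ¬ (i ≡ x × j ≡ y) → ¬ (i ≡ y × j ≡ x) → edge? x y i j ≡ false
    edge?-miss i j ≢xy ≢yx with i ≟ x | j ≟ y | i ≟ y | j ≟ x
    ... | yes p | yes q | _     | _     = ⊥-elim (≢xy (p , q))
    ... | _     | _     | yes p | yes q = ⊥-elim (≢yx (p , q))
    ... | yes _ | no _  | yes _ | no _  = refl
    ... | yes _ | no _  | no _  | _     = refl
    ... | no _  | _     | yes _ | no _  = refl
    ... | no _  | _     | no _  | _     = refl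

    not-difference : ∀ b c → ⟦ not b ⟧ - ⟦ not c ⟧ ≡ - (⟦ b ⟧ - ⟦ c ⟧)
    not-difference true  true  = refl
    not-difference true  false = refl
    not-difference false true  = refl
    not-difference false false = refl

  sign-flip : sign (flipEdge x y M) x y ≡ - sign M x y
  sign-flip rewrite arc-flip x y | arc-flip y x | sym (edge?-sym x y x y) | edge?-hit = not-difference
      (entry M x y) (entry M y x)

  sign-flip-other : ∀ i j → ¬ (i ≡ x × j ≡ y) → ¬ (i ≡ y × j ≡ x) → sign (flipEdge x y M) i j ≡ sign M i j
  sign-flip-other i j ≢xy ≢yx
    rewrite arc-flip i j | arc-flip j i | sym (edge?-sym x y i j) | edge?-miss i j ≢xy ≢yx = refl

-- The expectation is left unnormalised so that everything stays in ℤ; bounds on it carry the factor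
-- `#tournaments n` instead.
𝔼 : (Matrix n → ℤ) → ℤ
𝔼 {n} X = ∑ᴸ X (tournaments n)

#tournaments : ℕ → ℤ
#tournaments n = + length (tournaments n)

-- Summing over the permuted list shows that the sum equals its own negative.
𝔼-odd : ∀ {x y : Fin n} → x ≢ y → {X : Matrix n → ℤ} → (∀ M → X (flipEdge x y M) ≡ - X M) → 𝔼 X ≡ 0ℤ
𝔼-odd {n} {x} {y} x≢y {X} odd = self-negative (begin
  𝔼 X                                            ≡⟨ ∑ᴸ-↭ X (flipEdge-permutes x≢y) ⟩
  ∑ᴸ X (List.map (flipEdge x y) (tournaments n)) ≡⟨ ∑ᴸ-map X (flipEdge x y) (tournaments n) ⟩
  𝔼 (X ∘ flipEdge x y)                           ≡⟨ ∑ᴸ-cong odd (tournaments n) ⟩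
  𝔼 (λ M → - X M)                                ≡⟨ ∑ᴸ-neg X (tournaments n) ⟩
  - 𝔼 X                                          ∎)
  where
  open ≡-Reasoning
  self-negative : ∀ {i} → i ≡ - i → i ≡ 0ℤ
  self-negative {+ zero} _ = refl

-- Markov's inequality in the form that `ProbAtMost` asks for: a duplicate-free list of tournaments
-- is part of the full list, so its share of the sum of `X` is at most `b`.
markov : ∀ {X : Matrix n → ℤ} {b t} → (∀ M → 0ℤ ≤ X M) → 𝔼 X ≤ b → ∀ {L} → Unique L →
         All (λ M → IsTournament M × t ≤ X M) L → + length L * t ≤ b
markov {n} {X} 0≤X 𝔼X≤b u all = ℤ.≤-trans (∑ᴸ-≥ (All.map proj₂ all)) (ℤ.≤-trans
  (∑ᴸ-⊆ 0≤X u λ M∈ → tournament⇒∈ n (proj₁ (All.lookup all M∈))) 𝔼X≤b)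

-- Moments of signs

∣⟦⟧∣≤1 : ∀ b → ∣ ⟦ b ⟧ ∣ ℕ.≤ 1
∣⟦⟧∣≤1 true  = ℕ.≤-refl
∣⟦⟧∣≤1 false = ℕ.z≤n

0≤⟦⟧ : ∀ b → 0ℤ ≤ ⟦ b ⟧
0≤⟦⟧ true  = +≤+ ℕ.z≤n
0≤⟦⟧ false = +≤+ ℕ.z≤n

∣sign∣≤1 : ∀ (M : Matrix n) i j → ∣ sign M i j ∣ ℕ.≤ 1
∣sign∣≤1 M i j with entry M i j | entry M j i
... | true  | true  = ℕ.z≤n
... | true  | false = ℕ.≤-refl
... | false | true  = ℕ.≤-refl
... | false | false = ℕ.z≤n

∣*∣≤1 : ∀ i j → ∣ i ∣ ℕ.≤ 1 → ∣ j ∣ ℕ.≤ 1 → ∣ i * j ∣ ℕ.≤ 1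
∣*∣≤1 i j p q = subst (ℕ._≤ 1) (sym (ℤ.abs-* i j)) (ℕ.*-mono-≤ p q)

i≤∣i∣ : ∀ i → i ≤ + ∣ i ∣
i≤∣i∣ (+ _)    = ℤ.≤-refl
i≤∣i∣ -[1+ _ ] = -≤+

0≤#tournaments : ∀ n → 0ℤ ≤ #tournaments n
0≤#tournaments n = +≤+ ℕ.z≤n

𝔼-bounded : {X : Matrix n → ℤ} → (∀ M → ∣ X M ∣ ℕ.≤ 1) → 𝔼 X ≤ #tournaments n
𝔼-bounded {n} {X} X≤1 = ℤ.≤-trans (∑ᴸ-≤ (λ M → ℤ.≤-trans (i≤∣i∣ (X M)) (+≤+ (X≤1 M))) (tournaments n))
  (ℤ.≤-reflexive (ℤ.*-identityʳ _))

𝔼-cong : {X Y : Matrix n → ℤ} → (∀ M → X M ≡ Y M) → 𝔼 X ≡ 𝔼 Y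
𝔼-cong {n} X≡Y = ∑ᴸ-cong X≡Y (tournaments n)

𝔼-zero : {X : Matrix n → ℤ} → (∀ M → X M ≡ 0ℤ) → 𝔼 X ≡ 0ℤ
𝔼-zero {n} X≡0 = ≡.trans (𝔼-cong X≡0) (∑ᴸ-zero (tournaments n))
  where
  ∑ᴸ-zero : ∀ {A : Set} (xs : List A) → ∑ᴸ (λ _ → 0ℤ) xs ≡ 0ℤ
  ∑ᴸ-zero []       = refl
  ∑ᴸ-zero (_ ∷ xs) = ≡.trans (ℤ.+-identityˡ _) (∑ᴸ-zero xs)

-- A factor that ignores the edge {x , y} is uncorrelated with its sign. The case x ≡ y is covered
-- because diagonal signs vanish, which spares the callers a case distinction.
𝔼-sign-* : ∀ (x y : Fin n) (Y : Matrix n → ℤ) → (x ≢ y → ∀ M → Y (flipEdge x y M) ≡ Y M) →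
           𝔼 (λ M → sign M x y * Y M) ≡ 0ℤ
𝔼-sign-* x y Y even with x ≟ y
... | yes refl = 𝔼-zero λ M → ≡.trans (cong (_* Y M) (sign-diagonal M x)) (ℤ.*-zeroˡ (Y M))
... | no x≢y   = 𝔼-odd x≢y λ M → ≡.trans (cong₂ _*_ (sign-flip M x y) (even x≢y M))
  (sym (ℤ.neg-distribˡ-* (sign M x y) (Y M)))

δ : Fin n → Fin n → ℤ
δ i j = ⟦ does (i ≟ j) ⟧

δ-refl : (i : Fin n) → δ i i ≡ 1ℤ
δ-refl i = cong ⟦_⟧ (dec-true (i ≟ i) refl)

0≤δ : (i j : Fin n) → 0ℤ ≤ δ i j
0≤δ i j = 0≤⟦⟧ (does (i ≟ j))

∑-δ-* : ∀ (i : Fin n) x → ∑ (λ j → δ i j * x) ≡ x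
∑-δ-* {suc n} zero x = ≡.trans (∑-suc {n} _) (≡.trans (cong₂ _+_ (ℤ.*-identityˡ x)
  (≡.trans (∑-const n _) (ℤ.*-zeroʳ (+ n)))) (ℤ.+-identityʳ x))
∑-δ-* {suc n} (suc i) x = ≡.trans (∑-suc {n} _) (≡.trans (ℤ.+-identityˡ _) (∑-δ-* i x))

-- The signed count of 4-cycles

correlation : Matrix n → Fin n → Fin n → ℤ
correlation M y z = ∑ λ x → sign M x y * sign M x z

-- Expanding the square gives the signed count of closed walks y x z w, degenerate ones included.
-- Written as a sum of squares it is visibly nonnegative, as Markov requires.
fourCycles : Matrix n → ℤ
fourCycles M = ∑² λ y z → correlation M y z * correlation M y z

0≤fourCycles : (M : Matrix n) → 0ℤ ≤ fourCycles M
0≤fourCycles M = ∑-nonneg λ y → ∑-nonneg λ z → 0≤-square (correlation M y z)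

fourCycle : Fin n → Fin n → Fin n → Fin n → Matrix n → ℤ
fourCycle y z x w M = sign M x y * sign M x z * (sign M w y * sign M w z)

𝔼-fourCycle≤ : ∀ (y z x w : Fin n) → 𝔼 (fourCycle y z x w) ≤ #tournaments n
𝔼-fourCycle≤ y z x w = 𝔼-bounded λ M → ∣*∣≤1 (sign M x y * sign M x z) _
  (∣*∣≤1 (sign M x y) _ (∣sign∣≤1 M x y) (∣sign∣≤1 M x z)) (∣*∣≤1 (sign M w y) _ (∣sign∣≤1 M w y) (∣sign∣≤1 M w z))

-- If y ≢ z and x ≢ w, then either x ≡ z and a diagonal sign kills the product, or the edge {x , y}
-- occurs in one factor only and its reversal changes the sign. Each degenerate equality costs at
-- most `#tournaments n`.
𝔼-fourCycle : ∀ (y z x w : Fin n) → 𝔼 (fourCycle y z x w) ≤ δ y z * #tournaments n + δ x w * #tournaments n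
𝔼-fourCycle {n} y z x w with y ≟ z | x ≟ w
... | yes _  | d     = ℤ.≤-trans (𝔼-fourCycle≤ y z x w) (≤-by _ (0≤* (0≤⟦⟧ (does d)) (0≤#tournaments n))
  (cong (_+ ⟦ does d ⟧ * #tournaments n) (ℤ.*-identityˡ (#tournaments n))))
... | no _   | yes _ = ℤ.≤-trans (𝔼-fourCycle≤ y z x w) (ℤ.≤-reflexive
  (sym (≡.trans (ℤ.+-identityˡ _) (ℤ.*-identityˡ (#tournaments n)))))
... | no y≢z | no x≢w with x ≟ z
...   | yes refl = ℤ.≤-reflexive (𝔼-zero λ M →
        ≡.trans (cong (λ s → sign M x y * s * (sign M w y * sign M w x)) (sign-diagonal M x))
                (cong (_* (sign M w y * sign M w x)) (ℤ.*-zeroʳ (sign M x y))))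
...   | no x≢z = ℤ.≤-reflexive (≡.trans (𝔼-cong λ M → ℤ.*-assoc (sign M x y) (sign M x z) _)
        (𝔼-sign-* x y (λ M → sign M x z * (sign M w y * sign M w z)) λ x≢y M →
          cong₂ _*_ (sign-flip-other M x y x z (λ (_ , z≡y) → y≢z (sym z≡y)) (λ (x≡y , _) → x≢y x≡y))
          (cong₂ _*_ (sign-flip-other M x y w y (λ (w≡x , _) → x≢w (sym w≡x)) (λ (_ , y≡x) → x≢y (sym y≡x)))
                     (sign-flip-other M x y w z (λ (w≡x , _) → x≢w (sym w≡x)) (λ (_ , z≡x) → x≢z (sym z≡x))))))

-- Of the n⁴ quadruples only the n³ with y ≡ z and the n³ with x ≡ w contribute to the bound.
𝔼-fourCycles : 𝔼 {n} fourCycles ≤ + n * (+ n * (+ n * (+ 2 * #tournaments n)))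
𝔼-fourCycles {n} = begin
  𝔼 {n} fourCycles
    ≡⟨ 𝔼-cong {n} {fourCycles} (λ M → ∑-cong λ y → ∑-cong λ z → ∑-product _ _) ⟩
  𝔼 {n} (λ M → ∑ λ y → ∑ λ z → ∑ λ x → ∑ λ w → fourCycle y z x w M)
    ≡⟨ ≡.trans (∑ᴸ-∑ _ T) (∑-cong λ y → ≡.trans (∑ᴸ-∑ _ T)
        (∑-cong λ z → ≡.trans (∑ᴸ-∑ _ T) (∑-cong λ x → ∑ᴸ-∑ _ T))) ⟩
  (∑ λ y → ∑ λ z → ∑ λ x → ∑ λ w → 𝔼 (fourCycle y z x w))
    ≤⟨ (∑-mono λ y → ∑-mono λ z → ∑-mono λ x → ∑-mono λ w → 𝔼-fourCycle y z x w) ⟩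
  (∑ λ y → ∑ λ z → ∑ λ x → ∑ λ w → δ y z * N + δ x w * N)
    ≡⟨ (∑-cong λ y → ≡.trans (∑-cong λ z → ≡.trans (∑-cong λ x → row y z x) (∑-const n _)) (column y)) ⟩
  ∑ {n} (λ y → + n * (+ n * (+ 2 * N)))
    ≡⟨ ∑-const n _ ⟩
  + n * (+ n * (+ n * (+ 2 * N))) ∎
  where
  open ℤ.≤-Reasoning
  T = tournaments n
  N = #tournaments n
  row : ∀ (y z x : Fin n) → ∑ (λ w → δ y z * N + δ x w * N) ≡ + n * (δ y z * N) + N
  row y z x = ≡.trans (∑-+ _ _) (cong₂ _+_ (∑-const n _) (∑-δ-* x N))
  column : ∀ y → ∑ (λ z → + n * (+ n * (δ y z * N) + N)) ≡ + n * (+ n * (+ 2 * N))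
  column y = ≡.trans (sym (*-∑ (+ n) _)) (cong (_*_ (+ n)) (≡.trans (∑-+ _ _) (≡.trans
    (cong₂ _+_ (≡.trans (sym (*-∑ (+ n) _)) (cong (_*_ (+ n)) (∑-δ-* y N))) (∑-const n N))
    (solve 2 (λ n N → n :* N :+ n :* N := n :* (con (+ 2) :* N)) refl (+ n) N))))

-- Fourth moments of weighted sums of signs

∑-fourth-power : (t : Fin n → ℤ) → ∑ t * (∑ t * (∑ t * ∑ t)) ≡ ∑² λ v w → ∑² λ x y → t v * (t w * (t x * t y))
∑-fourth-power t = ≡.trans (∑-* t _) (∑-cong λ v → ≡.trans (cong (_*_ (t v)) (≡.trans (∑-* t _) (∑-cong λ w →
    ≡.trans (cong (_*_ (t w)) (∑-product t t)) (*-∑² (t w) _))))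
  (≡.trans (*-∑ (t v) _) (∑-cong λ w → *-∑² (t v) _)))
  where
  *-∑² : ∀ c (f : Fin _ → Fin _ → ℤ) → c * ∑² f ≡ ∑² λ i j → c * f i j
  *-∑² c f = ≡.trans (*-∑ c _) (∑-cong λ i → *-∑ c (f i))

-- One summand for each of the three ways to match four indices into two equal pairs.
pairings : Fin n → Fin n → Fin n → Fin n → ℤ → ℤ
pairings v w x y N = δ v w * (δ x y * N) + (δ v x * (δ w y * N) + δ v y * (δ w x * N))

∑-pairings : ∀ N → ∑² {n} (λ v w → ∑² λ x y → pairings v w x y N) ≡ + 3 * (+ n * (+ n * N))
∑-pairings {n} N = ≡.trans (∑-cong λ v → ≡.trans (∑-cong λ w → plane v w) (line v)) (≡.trans (∑-const n _)
  (solve 2 (λ n N → n :* (n :* N :+ (n :* N :+ n :* N)) := con (+ 3) :* (n :* (n :* N))) refl (+ n) N))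
  where
  plane : ∀ v w → ∑² (λ x y → pairings v w x y N) ≡ δ v w * (+ n * N) + (N + N)
  plane v w = begin
    ∑² (λ x y → pairings v w x y N)
      ≡⟨ (∑-cong λ x → ≡.trans (∑-+ _ _) (cong₂ _+_ (≡.trans (sym (*-∑ (δ v w) _)) (cong (_*_ (δ v w)) (∑-δ-* x N)))
           (≡.trans (∑-+ _ _) (cong₂ _+_ (≡.trans (sym (*-∑ (δ v x) _)) (cong (_*_ (δ v x)) (∑-δ-* w N)))
               (∑-δ-* v _))))) ⟩
    ∑ (λ x → δ v w * N + (δ v x * N + δ w x * N))
      ≡⟨ ≡.trans (∑-+ _ _) (cong₂ _+_ (∑-const n _) (≡.trans (∑-+ _ _) (cong₂ _+_ (∑-δ-* v N) (∑-δ-* w N)))) ⟩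
    + n * (δ v w * N) + (N + N)
      ≡⟨ cong (_+ (N + N)) (solve 3 (λ n d N → n :* (d :* N) := d :* (n :* N)) refl (+ n) (δ v w) N) ⟩
    δ v w * (+ n * N) + (N + N) ∎
    where open ≡-Reasoning
  line : ∀ v → ∑ (λ w → δ v w * (+ n * N) + (N + N)) ≡ + n * N + (+ n * N + + n * N)
  line v = ≡.trans (∑-+ _ _) (cong₂ _+_ (∑-δ-* v _) (≡.trans (∑-const n _) (ℤ.*-distribˡ-+ (+ n) N N)))

module FourthMoment (β : Fin n → Fin n → ℤ) (∣β∣≤1 : ∀ i j → ∣ β i j ∣ ℕ.≤ 1) where

  bias : Matrix n → Fin n → ℤ
  bias M r = ∑ λ v → β r v * sign M r v

  -- Summing over `r` acts as a union bound over all roots. Fourth powers give an expectation of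
  -- order n³, far below the fourth power of a linear error; second powers would give n², the same
  -- order as the square of a linear error.
  quartic : Matrix n → ℤ
  quartic M = ∑ λ r → bias M r * (bias M r * (bias M r * bias M r))

  0≤quartic-term : ∀ M r → 0ℤ ≤ bias M r * (bias M r * (bias M r * bias M r))
  0≤quartic-term M r = subst (0ℤ ≤_) (ℤ.*-assoc b b (b * b)) (0≤* (0≤-square b) (0≤-square b))
    where b = bias M r

  0≤quartic : ∀ M → 0ℤ ≤ quartic M
  0≤quartic M = ∑-nonneg (0≤quartic-term M)

  private
    module _ (r : Fin n) where
      t : Fin n → Matrix n → ℤ
      t v M = β r v * sign M r v

      monomial : (v w x y : Fin n) → Matrix n → ℤ
      monomial v w x y M = t v M * (t w M * (t x M * t y M))

      ∣t∣≤1 : ∀ v M → ∣ t v M ∣ ℕ.≤ 1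
      ∣t∣≤1 v M = ∣*∣≤1 (β r v) _ (∣β∣≤1 r v) (∣sign∣≤1 M r v)

      𝔼-monomial≤ : ∀ v w x y → 𝔼 (monomial v w x y) ≤ #tournaments n
      𝔼-monomial≤ v w x y = 𝔼-bounded λ M →
        ∣*∣≤1 (t v M) _ (∣t∣≤1 v M) (∣*∣≤1 (t w M) _ (∣t∣≤1 w M) (∣*∣≤1 (t x M) _ (∣t∣≤1 x M) (∣t∣≤1 y M)))

      -- The edge {r , v} enters the monomial through `t v` alone, so reversing it negates the
      -- monomial.
      𝔼-singleton : ∀ {v w x y} → v ≢ w → v ≢ x → v ≢ y → 𝔼 (monomial v w x y) ≡ 0ℤ
      𝔼-singleton {v} {w} {x} {y} v≢w v≢x v≢y = ≡.trans
        (𝔼-cong λ M → solve 3 (λ b s m → (b :* s) :* m := s :* (b :* m)) refl (β r v) (sign M r v)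
            (t w M * (t x M * t y M)))
        (𝔼-sign-* r v (λ M → β r v * (t w M * (t x M * t y M))) λ r≢v M →
          cong (_*_ (β r v)) (cong₂ _*_ (t-flip r≢v M v≢w) (cong₂ _*_ (t-flip r≢v M v≢x) (t-flip r≢v M v≢y))))
        where
        t-flip : r ≢ v → ∀ M {u} → v ≢ u → t u (flipEdge r v M) ≡ t u M
        t-flip r≢v M {u} v≢u = cong (_*_ (β r u)) (sign-flip-other M r v r u (λ (_ , u≡v) → v≢u (sym u≡v))
            (λ (r≡v , _) → r≢v r≡v))

      N = #tournaments n

      0≤δδN : ∀ (i j k l : Fin n) → 0ℤ ≤ δ i j * (δ k l * N)
      0≤δδN i j k l = 0≤* (0≤δ i j) (0≤* (0≤δ k l) (0≤#tournaments n))

      δδN : ∀ (i k : Fin n) → δ i i * (δ k k * N) ≡ N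
      δδN i k = ≡.trans (cong₂ (λ a b → a * (b * N)) (δ-refl i) (δ-refl k))
          (≡.trans (ℤ.*-identityˡ _) (ℤ.*-identityˡ N))

      -- Unless the four indices can be paired up, one of them occurs exactly once, and flipping its edge
      -- changes the sign of the monomial.
      𝔼-monomial : ∀ v w x y → 𝔼 (monomial v w x y) ≤ pairings v w x y N
      𝔼-monomial v w x y = cases (v ≟ w) (v ≟ x) (v ≟ y) (w ≟ x) (w ≟ y) (x ≟ y)
        where
        zero-case : 𝔼 (monomial v w x y) ≡ 0ℤ → 𝔼 (monomial v w x y) ≤ pairings v w x y N
        zero-case e = ℤ.≤-trans (ℤ.≤-reflexive e) (0≤+ (0≤δδN v w x y) (0≤+ (0≤δδN v x w y) (0≤δδN v y w x)))

        swapped : ∀ {a b c d} → (∀ M → monomial v w x y M ≡ monomial a b c d M) → a ≢ b → a ≢ c → a ≢ d →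
                  𝔼 (monomial v w x y) ≤ pairings v w x y N
        swapped e p q s = zero-case (≡.trans (𝔼-cong e) (𝔼-singleton p q s))

        w-first : w ≢ v → w ≢ x → w ≢ y → 𝔼 (monomial v w x y) ≤ pairings v w x y N
        w-first = swapped λ M → solve 4 (λ v w x y → v :* (w :* (x :* y)) := w :* (v :* (x :* y))) refl (t v M)
            (t w M) (t x M) (t y M)
        x-first : x ≢ v → x ≢ w → x ≢ y → 𝔼 (monomial v w x y) ≤ pairings v w x y N
        x-first = swapped λ M → solve 4 (λ v w x y → v :* (w :* (x :* y)) := x :* (v :* (w :* y))) refl (t v M)
            (t w M) (t x M) (t y M)
        y-first : y ≢ v → y ≢ w → y ≢ x → 𝔼 (monomial v w x y) ≤ pairings v w x y N
        y-first = swapped λ M → solve 4 (λ v w x y → v :* (w :* (x :* y)) := y :* (v :* (w :* x))) refl (t v M)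
            (t w M) (t x M) (t y M)

        one-case : ∀ {a b} → pairings v w x y N ≡ N + (a + b) → 0ℤ ≤ a → 0ℤ ≤ b →
                   𝔼 (monomial v w x y) ≤ pairings v w x y N
        one-case {a} {b} e 0≤a 0≤b = ℤ.≤-trans (𝔼-monomial≤ v w x y) (≤-by (a + b) (0≤+ 0≤a 0≤b) e)

        cases : Dec (v ≡ w) → Dec (v ≡ x) → Dec (v ≡ y) → Dec (w ≡ x) → Dec (w ≡ y) → Dec (x ≡ y) →
                𝔼 (monomial v w x y) ≤ pairings v w x y N
        cases (yes refl) _ _ _ _ (yes refl) =
          one-case (cong (_+ (δ v x * (δ w y * N) + δ v y * (δ w x * N))) (δδN v x)) (0≤δδN v x w y) (0≤δδN v y w x)
        cases (yes refl) (yes refl) _ _ _ (no x≢y) = y-first (x≢y ∘ sym) (x≢y ∘ sym) (x≢y ∘ sym)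
        cases (yes refl) (no v≢x) _ _ _ (no x≢y) = x-first (v≢x ∘ sym) (v≢x ∘ sym) x≢y
        cases (no v≢w) (yes refl) _ _ (yes refl) _ =
          one-case (≡.trans (cong (λ z → δ v w * (δ x y * N) + (z + δ v y * (δ w x * N))) (δδN v w))
          (solve 3 (λ a N b → a :+ (N :+ b) := N :+ (a :+ b)) refl (δ v w * (δ x y * N)) N
              (δ v y * (δ w x * N)))) (0≤δδN v w x y) (0≤δδN v y w x)
        cases (no v≢w) (yes refl) _ _ (no w≢y) _ = w-first (v≢w ∘ sym) (v≢w ∘ sym) w≢y
        cases (no v≢w) (no v≢x) (yes refl) (yes refl) _ _ =
          one-case (≡.trans (cong (λ z → δ v w * (δ x y * N) + (δ v x * (δ w y * N) + z)) (δδN v w))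
          (solve 3 (λ a b N → a :+ (b :+ N) := N :+ (a :+ b)) refl (δ v w * (δ x y * N))
              (δ v x * (δ w y * N)) N)) (0≤δδN v w x y) (0≤δδN v x w y)
        cases (no v≢w) (no v≢x) (yes refl) (no w≢x) _ _ = w-first (v≢w ∘ sym) w≢x (v≢w ∘ sym)
        cases (no v≢w) (no v≢x) (no v≢y) _ _ _ = zero-case (𝔼-singleton v≢w v≢x v≢y)

  -- There are n roots, and the pairings sum to 3n² for each of them.
  𝔼-quartic : 𝔼 quartic ≤ + n * (+ 3 * (+ n * (+ n * #tournaments n)))
  𝔼-quartic = begin
    𝔼 quartic
      ≡⟨ 𝔼-cong {n} {quartic} (λ M → ∑-cong λ r → ∑-fourth-power _) ⟩
    𝔼 (λ M → ∑ λ r → ∑ λ v → ∑ λ w → ∑ λ x → ∑ λ y → monomial r v w x y M)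
      ≡⟨ ≡.trans (∑ᴸ-∑ _ T) (∑-cong λ r → ≡.trans (∑ᴸ-∑ _ T) (∑-cong λ v → ≡.trans (∑ᴸ-∑ _ T) (∑-cong λ w →
           ≡.trans (∑ᴸ-∑ _ T) (∑-cong λ x → ∑ᴸ-∑ _ T)))) ⟩
    (∑ λ r → ∑ λ v → ∑ λ w → ∑ λ x → ∑ λ y → 𝔼 (monomial r v w x y))
      ≤⟨ (∑-mono λ r → ∑-mono λ v → ∑-mono λ w → ∑-mono λ x → ∑-mono λ y → 𝔼-monomial r v w x y) ⟩
    (∑ λ (r : Fin n) → ∑² λ v w → ∑² λ x y → pairings v w x y (#tournaments n))
      ≡⟨ ≡.trans (∑-cong λ r → ∑-pairings (#tournaments n)) (∑-const n _) ⟩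
    + n * (+ 3 * (+ n * (+ n * #tournaments n))) ∎
    where
    open ℤ.≤-Reasoning
    T = tournaments n

-- Discrepancy between vertex sets

discrepancy : Matrix n → (Fin n → ℤ) → (Fin n → ℤ) → ℤ
discrepancy M f g = ∑² λ x y → f x * g y * sign M x y

module _ (M : Matrix n) (f g : Fin n → ℤ) (∣f∣≤1 : ∀ i → ∣ f i ∣ ℕ.≤ 1) (∣g∣≤1 : ∀ i → ∣ g i ∣ ℕ.≤ 1) where
  private
    h : Fin n → ℤ
    h x = ∑ λ y → g y * sign M x y

    H = ∑ λ x → h x * h x
    D = discrepancy M f g

    D≡ : D ≡ ∑ λ x → f x * h x
    D≡ = ∑-cong λ x → ≡.trans (∑-cong λ y → ℤ.*-assoc (f x) (g y) _) (sym (*-∑ (f x) _))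

    -- Cauchy-Schwarz over `x` removes the arbitrary weights `f`.
    D²≤ : D * D ≤ + n * H
    D²≤ = begin
      D * D                               ≡⟨ cong (λ d → d * d) D≡ ⟩
      (∑ λ x → f x * h x) * (∑ λ x → f x * h x) ≤⟨ ∑-square≤ (λ x → f x * h x) ⟩
      + n * (∑ λ x → (f x * h x) * (f x * h x))
        ≤⟨ ℤ.*-monoˡ-≤-nonNeg (+ n) (∑-mono λ x → ∣f∣≤1⇒square≤ (f x) (h x) (∣f∣≤1 x)) ⟩
      + n * H                             ∎
      where open ℤ.≤-Reasoning

    -- Expanding the squares and summing over `x` first isolates the correlations, which depend on
    -- the tournament only.
    H≡ : H ≡ ∑² λ y z → g y * (g z * correlation M y z)
    H≡ = begin
      H ≡⟨ (∑-cong λ x → ∑-product _ _) ⟩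
      (∑ λ x → ∑ λ y → ∑ λ z → g y * sign M x y * (g z * sign M x z)) ≡⟨ ∑-swap _ ⟩
      (∑ λ y → ∑ λ x → ∑ λ z → g y * sign M x y * (g z * sign M x z)) ≡⟨ (∑-cong λ y → ∑-swap _) ⟩
      (∑ λ y → ∑ λ z → ∑ λ x → g y * sign M x y * (g z * sign M x z))
        ≡⟨ (∑-cong λ y → ∑-cong λ z → ≡.trans (∑-cong λ x →
             solve 4 (λ a b c d → a :* b :* (c :* d) := a :* (c :* (b :* d))) refl (g y) (sign M x y) (g z)
                 (sign M x z))
             (≡.trans (sym (*-∑ (g y) _)) (cong (_*_ (g y)) (sym (*-∑ (g z) _))))) ⟩
      (∑² λ y z → g y * (g z * correlation M y z)) ∎
      where open ≡-Reasoning

    -- Cauchy-Schwarz over `y` and then over `z` removes both copies of the weights `g`.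
    H²≤ : H * H ≤ + n * (+ n * fourCycles M)
    H²≤ = begin
      H * H ≡⟨ cong (λ d → d * d) H≡ ⟩
      (∑² λ y z → F y z) * (∑² λ y z → F y z) ≤⟨ ∑-square≤ (λ y → ∑ (F y)) ⟩
      + n * (∑ λ y → ∑ (F y) * ∑ (F y)) ≤⟨ ℤ.*-monoˡ-≤-nonNeg (+ n) (∑-mono λ y → ∑-square≤ (F y)) ⟩
      + n * (∑ λ y → + n * ∑ λ z → F y z * F y z) ≡⟨ cong (_*_ (+ n)) (sym (*-∑ (+ n) _)) ⟩
      + n * (+ n * ∑² λ y z → F y z * F y z)
        ≤⟨ ℤ.*-monoˡ-≤-nonNeg (+ n) (ℤ.*-monoˡ-≤-nonNeg (+ n) (∑-mono λ y → ∑-mono λ z → ℤ.≤-trans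
             (∣f∣≤1⇒square≤ (g y) (g z * correlation M y z) (∣g∣≤1 y))
                 (∣f∣≤1⇒square≤ (g z) (correlation M y z) (∣g∣≤1 z)))) ⟩
      + n * (+ n * fourCycles M) ∎
      where
      open ℤ.≤-Reasoning
      F : Fin n → Fin n → ℤ
      F y z = g y * (g z * correlation M y z)

  -- The right-hand side is free of `f` and `g`, so one event on `fourCycles M` controls all pairs
  -- of sets at once, including those chosen by an adversarial colouring.
  discrepancy⁴≤ : (D * D) * (D * D) ≤ (+ n * + n) * (+ n * + n) * fourCycles M
  discrepancy⁴≤ = begin
    (D * D) * (D * D)       ≤⟨ square-mono (0≤-square D) D²≤ ⟩
    (+ n * H) * (+ n * H)   ≡⟨ solve 2 (λ n H → (n :* H) :* (n :* H) := n :* (n :* (H :* H))) refl (+ n) H ⟩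
    + n * (+ n * (H * H))   ≤⟨ ℤ.*-monoˡ-≤-nonNeg (+ n) (ℤ.*-monoˡ-≤-nonNeg (+ n) H²≤) ⟩
    + n * (+ n * (+ n * (+ n * fourCycles M)))
      ≡⟨ solve 2 (λ n Q → n :* (n :* (n :* (n :* Q))) := (n :* n) :* (n :* n) :* Q) refl (+ n) (fourCycles M) ⟩
    (+ n * + n) * (+ n * + n) * fourCycles M ∎
    where open ℤ.≤-Reasoning

-- The upper bound

+∣p∣≡∑ : (p : Subset n) → + Subset.∣ p ∣ ≡ ∑ λ v → ⟦ lookup p v ⟧
+∣p∣≡∑ []          = sym (∑-empty _)
+∣p∣≡∑ (true ∷ p)  = ≡.trans (ℤ.pos-+ 1 Subset.∣ p ∣) (≡.trans (cong (_+_ 1ℤ) (+∣p∣≡∑ p)) (sym (∑-suc _)))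
+∣p∣≡∑ (false ∷ p) = ≡.trans (+∣p∣≡∑ p) (≡.trans (sym (ℤ.+-identityˡ _)) (sym (∑-suc _)))

side : Fin n → Bool
side zero    = true
side (suc i) = not (side i)

sameSide : Fin n → Fin n → Bool
sameSide i j = not (side i xor side j)

-- The sides alternate, and the class `true` contains vertex zero, so only it can exceed half.
-- Removing vertex zero exchanges the classes, hence the induction alternates between the values of
-- `b`.
∑-side : ∀ n b → ∑ (λ (v : Fin n) → ⟦ not (b xor side v) ⟧) + ∑ (λ (v : Fin n) → ⟦ not (b xor side v) ⟧) ≤ + n + ⟦ b ⟧
∑-side zero b = ℤ.≤-trans (ℤ.≤-reflexive (cong₂ _+_ (∑-empty _) (∑-empty _))) (0≤+ ℤ.≤-refl (0≤⟦⟧ b))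
∑-side (suc n) true = begin
  ∑ f + ∑ f ≡⟨ cong (λ z → z + z) (≡.trans (∑-suc f) (cong (_+_ 1ℤ) (∑-cong λ v → cong ⟦_⟧ (not-involutive _)))) ⟩
  (1ℤ + R) + (1ℤ + R) ≡⟨ solve 1 (λ r → (con 1ℤ :+ r) :+ (con 1ℤ :+ r) := con (+ 2) :+ (r :+ r)) refl R ⟩
  + 2 + (R + R) ≤⟨ ℤ.+-monoʳ-≤ (+ 2) (∑-side n false) ⟩
  + 2 + (+ n + 0ℤ) ≡⟨ solve 1 (λ n → con (+ 2) :+ (n :+ con 0ℤ) := (con 1ℤ :+ n) :+ con 1ℤ) refl (+ n) ⟩
  + suc n + 1ℤ ∎
  where
  open ℤ.≤-Reasoning
  f : Fin (suc n) → ℤ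
  f v = ⟦ not (true xor side v) ⟧
  R = ∑ λ (v : Fin n) → ⟦ not (false xor side v) ⟧
∑-side (suc n) false = begin
  ∑ f + ∑ f ≡⟨ cong (λ z → z + z) (≡.trans (∑-suc f) (ℤ.+-identityˡ R)) ⟩
  R + R ≤⟨ ∑-side n true ⟩
  + n + 1ℤ ≡⟨ solve 1 (λ n → n :+ con 1ℤ := (con 1ℤ :+ n) :+ con 0ℤ) refl (+ n) ⟩
  + suc n + 0ℤ ∎
  where
  open ℤ.≤-Reasoning
  f : Fin (suc n) → ℤ
  f v = ⟦ not (false xor side v) ⟧
  R = ∑ λ (v : Fin n) → ⟦ not (true xor side v) ⟧

bipartite : Colouring n
bipartite i j = if side i xor side j then suc zero else zero

opposite : Fin n → Fin n → ℤ
opposite i j = ⟦ side i xor side j ⟧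

-- With these weights `bias M r` is, for a tournament, the out-degree minus the in-degree of `r`
-- towards the opposite half.
module Bipartite {n} = FourthMoment {n} opposite (λ i j → ∣⟦⟧∣≤1 (side i xor side j))
open Bipartite

-- Two arcs of the same colour cross between the halves twice or not at all.
two-steps : ∀ (i j k : Fin n) → bipartite i j ≡ bipartite j k → side i xor side k ≡ false
two-steps i j k e with side i | side j | side k
... | true  | true  | true  = refl
... | true  | false | true  = refl
... | false | true  | false = refl
... | false | false | false = refl
... | true  | true  | false with () ← e
... | true  | false | false with () ← e
... | false | true  | true  with () ← e
... | false | false | true  with () ← e

module _ {M : Matrix n} (tour : IsTournament M) (A : PMArb2 M bipartite) where
  open PMArb2 A

  -- A grandchild lies in the half of the root by `two-steps`, so a vertex of the opposite half must
  -- be a child.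
  opposite-arc : ∀ v → v Subset.∈ verts → side root xor side v ≡ true → Arc M root v
  opposite-arc v v∈ opp with v ≟ root
  ... | yes refl with () ← ≡.trans (sym opp) (xor-same (side v))
  ... | no v≢root with parent v ≟ root
  ...   | yes p≡root = subst (λ p → Arc M p v) p≡root (parentArc v v∈ v≢root)
  ...   | no p≢root with depth≤2 v v∈ v≢root
  ...     | inj₁ p≡root = ⊥-elim (p≢root p≡root)
  ...     | inj₂ pp≡root with () ← ≡.trans (sym opp) (two-steps root (parent v) v
              (≡.trans (cong (λ z → bipartite z (parent v)) (sym pp≡root)) (mono v v∈ v≢root p≢root)))

  private
    -- In the root's half the right side is 4. In the opposite half it is 2 + 2·sign, which is 4 for
    -- an out-neighbour of the root and 0 for an in-neighbour.
    vertex-bound : ∀ v → + 4 * ⟦ lookup verts v ⟧ ≤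
      (⟦ sameSide root v ⟧ + ⟦ sameSide root v ⟧) + (+ 2 + + 2 * (opposite root v * sign M root v))
    vertex-bound v with lookup verts v in v∈ | side root xor side v in opp
    ... | true  | false = ℤ.≤-refl
    ... | false | false = +≤+ ℕ.z≤n
    ... | true  | true  = ℤ.≤-reflexive (sym (cong (λ z → 0ℤ + (+ 2 + + 2 * (1ℤ * z))) sign≡1))
      where
      root→v : entry M root v ≡ true
      root→v = opposite-arc v (lookup⇒[]= v verts v∈) opp
      root≢v : root ≢ v
      root≢v r≡v with () ← ≡.trans (sym opp) (≡.trans (cong (λ z → side root xor side z) (sym r≡v))
          (xor-same (side root)))
      sign≡1 : sign M root v ≡ 1ℤ
      sign≡1 with entry M root v | entry M v root | proj₂ tour root v root≢v | root→v
      ... | true | false | _ | _ = refl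
    ... | false | true  with sign M root v | ∣sign∣≤1 M root v
    ...   | + 0    | _ = +≤+ ℕ.z≤n
    ...   | + 1    | _ = +≤+ ℕ.z≤n
    ...   | -[1+ 0 ] | _ = ℤ.≤-refl
    ...   | + suc (suc _) | ℕ.s≤s ()
    ...   | -[1+ suc _ ]  | ℕ.s≤s ()

  arborescence-bound : + 4 * + Subset.∣ verts ∣ ≤ + 3 * + n + 1ℤ + + 2 * bias M root
  arborescence-bound = begin
    + 4 * + Subset.∣ verts ∣ ≡⟨ ≡.trans (cong (_*_ (+ 4)) (+∣p∣≡∑ verts)) (*-∑ (+ 4) _) ⟩
    ∑ (λ v → + 4 * ⟦ lookup verts v ⟧) ≤⟨ ∑-mono vertex-bound ⟩
    ∑ (λ v → (⟦ sameSide root v ⟧ + ⟦ sameSide root v ⟧) + (+ 2 + + 2 * (opposite root v * sign M root v)))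
      ≡⟨ ≡.trans (∑-+ _ _) (cong₂ _+_ (∑-+ _ _) (≡.trans (∑-+ _ _)
          (cong₂ _+_ (∑-const n (+ 2)) (sym (*-∑ (+ 2) _))))) ⟩
    (Same + Same) + (+ n * + 2 + + 2 * bias M root)
      ≤⟨ ℤ.+-monoˡ-≤ _ (ℤ.≤-trans (∑-side n (side root)) (ℤ.+-monoʳ-≤ (+ n) (⟦⟧≤1 (side root)))) ⟩
    (+ n + 1ℤ) + (+ n * + 2 + + 2 * bias M root)
      ≡⟨ solve 2 (λ n b → (n :+ con 1ℤ) :+ (n :* con (+ 2) :+ con (+ 2) :* b) := con (+ 3) :* n :+ con 1ℤ :+ con
          (+ 2) :* b) refl (+ n) (bias M root) ⟩
    + 3 * + n + 1ℤ + + 2 * bias M root ∎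
    where
    open ℤ.≤-Reasoning
    Same = ∑ λ v → ⟦ sameSide root v ⟧
    ⟦⟧≤1 : ∀ b → ⟦ b ⟧ ≤ 1ℤ
    ⟦⟧≤1 b = ℤ.≤-trans (i≤∣i∣ ⟦ b ⟧) (+≤+ (∣⟦⟧∣≤1 b))

upper-deterministic : ∀ {M : Matrix n} e → IsTournament M →
  quartic M < + (2 ℕ.* e) * (+ (2 ℕ.* e) * (+ (2 ℕ.* e) * + (2 ℕ.* e))) →
  ∀ m → Guarantees M m → 4 ℕ.* m ℕ.≤ 3 ℕ.* n ℕ.+ 4 ℕ.* e
upper-deterministic {n} {M} e tour small m guar = ℤ.drop‿+≤+ (begin
  + (4 ℕ.* m)                            ≤⟨ +≤+ (ℕ.*-monoʳ-≤ 4 (proj₂ (guar bipartite))) ⟩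
  + (4 ℕ.* Subset.∣ verts tree ∣)           ≡⟨ ℤ.pos-* 4 (Subset.∣ verts tree ∣) ⟩
  + 4 * + Subset.∣ verts tree ∣             ≤⟨ arborescence-bound tour tree ⟩
  + 3 * + n + 1ℤ + + 2 * b
    -- The bound b < 2e is strict over ℤ, so 1 + b ≤ 2e absorbs the additive 1 left by an odd number
    -- of vertices.
    ≤⟨ ≤-by 1ℤ (+≤+ ℕ.z≤n) (solve 2 (λ n b → con (+ 3) :* n :+ con (+ 2) :* (con 1ℤ :+ b) := con
        (+ 3) :* n :+ con 1ℤ :+ con (+ 2) :* b :+ con 1ℤ) refl (+ n) b) ⟩
  + 3 * + n + + 2 * (1ℤ + b)             ≤⟨ ℤ.+-monoʳ-≤ (+ 3 * + n) (ℤ.*-monoˡ-≤-nonNeg (+ 2) (ℤ.i<j⇒suc[i]≤j b<)) ⟩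
  + 3 * + n + + 2 * + (2 ℕ.* e)
    ≡⟨ cong₂ _+_ (sym (ℤ.pos-* 3 n)) (≡.trans (sym (ℤ.pos-* 2 (2 ℕ.* e))) (cong +_ (sym (ℕ.*-assoc 2 2 e)))) ⟩
  + (3 ℕ.* n) + + (4 ℕ.* e)              ≡⟨ ℤ.pos-+ (3 ℕ.* n) (4 ℕ.* e) ⟨
  + (3 ℕ.* n ℕ.+ 4 ℕ.* e) ∎)
  where
  open ℤ.≤-Reasoning
  open PMArb2
  tree = proj₁ (guar bipartite)
  b = bias M (root tree)
  b< : b < + (2 ℕ.* e)
  -- The fourth power of the root's bias is one nonnegative term of `quartic M`, so a large bias
  -- would make the whole sum large.
  b< = ℤ.≰⇒> λ 2e≤b → ℤ.<⇒≱ small (ℤ.≤-trans (fourth-power-mono (+≤+ ℕ.z≤n) 2e≤b)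
      (term≤∑ (0≤quartic-term M) (root tree)))

-- The lower bound

module Reach {n} (M : Matrix n) (c : Colouring n) where

  MonoPath : Fin n → Fin n → Set
  MonoPath v w = ∃ λ x → Arc M v x × Arc M x w × c v x ≡ c x w

  arc? : ∀ v w → Dec (Arc M v w)
  arc? v w = entry M v w Bool.≟ true

  monoPath? : ∀ v w → Dec (MonoPath v w)
  monoPath? v w = any? λ x → arc? v x ×-dec arc? x w ×-dec (c v x ≟ c x w)

  Reached : Fin n → Fin n → Set
  Reached v w = w ≡ v ⊎ Arc M v w ⊎ MonoPath v w

  reached? : ∀ v w → Dec (Reached v w)
  reached? v w = (w ≟ v) ⊎-dec arc? v w ⊎-dec monoPath? v w

  missed : Fin n → Fin n → Bool
  missed v w = not (does (reached? v w))

  missed⇒¬Reached : ∀ v w → missed v w ≡ true → ¬ Reached v w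
  missed⇒¬Reached v w e r with () ← ≡.trans (sym e) (cong not (dec-true (reached? v w) r))

  reachedSet : Fin n → Subset n
  reachedSet v = tabulate λ w → does (reached? v w)

  ∈-reachedSet : ∀ {v w} → Reached v w → w Subset.∈ reachedSet v
  ∈-reachedSet {v} {w} r = lookup⇒[]= w _ (≡.trans (lookup∘tabulate _ w) (dec-true (reached? v w) r))

  reachedSet-∈ : ∀ {v w} → w Subset.∈ reachedSet v → Reached v w
  reachedSet-∈ {v} {w} w∈ = does-true (reached? v w)
    (≡.trans (sym (lookup∘tabulate (λ w → does (reached? v w)) w)) ([]=⇒lookup w∈))
    where
    does-true : ∀ {P : Set} (d : Dec P) → does d ≡ true → P
    does-true (yes p) _ = p

  -- A direct arc takes precedence: the middle vertex of a chosen path is an out-neighbour of `v`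
  -- and so gets `v` as its parent. The last clause is a default, reached only at `v` itself or
  -- outside `reachedSet v`.
  parentOf : Fin n → Fin n → Fin n
  parentOf v w with arc? v w | monoPath? v w
  ... | yes _ | _           = v
  ... | no _  | yes (x , _) = x
  ... | no _  | no _        = v

  parentOf-arc : ∀ {v w} → Arc M v w → parentOf v w ≡ v
  parentOf-arc {v} {w} a with arc? v w | monoPath? v w
  ... | yes _ | _ = refl
  ... | no ¬a | _ = ⊥-elim (¬a a)

  parentOf-spec : ∀ {v w} → w Subset.∈ reachedSet v → w ≢ v →
    (parentOf v w ≡ v × Arc M v w) ⊎
    (Arc M v (parentOf v w) × Arc M (parentOf v w) w × c v (parentOf v w) ≡ c (parentOf v w) w)
  parentOf-spec {v} {w} w∈ w≢v with arc? v w | monoPath? v w | reachedSet-∈ w∈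
  ... | yes a | _           | _                = inj₁ (refl , a)
  ... | no _  | yes (_ , p) | _                = inj₂ p
  ... | no _  | no _        | inj₁ w≡v         = ⊥-elim (w≢v w≡v)
  ... | no ¬a | no _        | inj₂ (inj₁ a)    = ⊥-elim (¬a a)
  ... | no _  | no ¬p       | inj₂ (inj₂ p)    = ⊥-elim (¬p p)

  -- All vertices reached from `v` fit into a single tree, so a root that misses few vertices
  -- provides the large arborescence.
  arborescence : Fin n → PMArb2 M c
  arborescence v = record
    { root      = v
    ; verts     = reachedSet v
    ; parent    = parentOf v
    ; root∈     = root∈
    ; parent∈   = λ w w∈ w≢v → parent∈ (parentOf-spec w∈ w≢v)
    ; parentArc = λ w w∈ w≢v → parentArc (parentOf-spec w∈ w≢v)
    ; depth≤2   = λ w w∈ w≢v → depth≤2 (parentOf-spec w∈ w≢v)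
    ; mono      = λ w w∈ w≢v p≢v → mono p≢v (parentOf-spec w∈ w≢v)
    }
    where
    Spec : Fin n → Set
    Spec w = (parentOf v w ≡ v × Arc M v w) ⊎
      (Arc M v (parentOf v w) × Arc M (parentOf v w) w × c v (parentOf v w) ≡ c (parentOf v w) w)
    root∈ : v Subset.∈ reachedSet v
    root∈ = ∈-reachedSet (inj₁ refl)
    parent∈ : ∀ {w} → Spec w → parentOf v w Subset.∈ reachedSet v
    parent∈ (inj₁ (p≡v , _)) = subst (Subset._∈ reachedSet v) (sym p≡v) root∈
    parent∈ (inj₂ (a , _))   = ∈-reachedSet (inj₂ (inj₁ a))
    parentArc : ∀ {w} → Spec w → Arc M (parentOf v w) w
    parentArc {w} (inj₁ (p≡v , a)) = subst (λ p → Arc M p w) (sym p≡v) a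
    parentArc (inj₂ (_ , a , _))   = a
    depth≤2 : ∀ {w} → Spec w → parentOf v w ≡ v ⊎ parentOf v (parentOf v w) ≡ v
    depth≤2 (inj₁ (p≡v , _)) = inj₁ p≡v
    depth≤2 (inj₂ (a , _))   = inj₂ (parentOf-arc a)
    mono : ∀ {w} → parentOf v w ≢ v → Spec w → c (parentOf v (parentOf v w)) (parentOf v w) ≡ c (parentOf v w) w
    mono p≢v (inj₁ (p≡v , _))    = ⊥-elim (p≢v p≡v)
    mono {w} _ (inj₂ (a , _ , e)) = ≡.trans (cong (λ z → c z (parentOf v w)) (parentOf-arc a)) e

  u : Fin n → Fin n → ℤ
  u v w = ⟦ missed v w ⟧

  reached+missed : ∀ v → + Subset.∣ reachedSet v ∣ + ∑ (u v) ≡ + n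
  reached+missed v = begin
    + Subset.∣ reachedSet v ∣ + ∑ (u v) ≡⟨ cong (_+ ∑ (u v)) (+∣p∣≡∑ (reachedSet v)) ⟩
    ∑ (λ w → ⟦ lookup (reachedSet v) w ⟧) + ∑ (u v) ≡⟨ ∑-+ _ _ ⟨
    ∑ (λ w → ⟦ lookup (reachedSet v) w ⟧ + u v w)
      ≡⟨ ∑-cong (λ w → ≡.trans (cong (λ b → ⟦ b ⟧ + u v w) (lookup∘tabulate _ w))
          (complement (does (reached? v w)))) ⟩
    ∑ {n} (λ _ → 1ℤ) ≡⟨ ≡.trans (∑-const n 1ℤ) (ℤ.*-identityʳ (+ n)) ⟩
    + n ∎
    where
    open ≡-Reasoning
    complement : ∀ b → ⟦ b ⟧ + ⟦ not b ⟧ ≡ 1ℤ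
    complement true  = refl
    complement false = refl

-- Counting arcs between disjoint sets

module _ (M : Matrix n) (tour : IsTournament M) where

  arc-asym : ∀ i j → Arc M i j → ¬ Arc M j i
  arc-asym i j a b with i ≟ j
  ... | yes refl with () ← ≡.trans (sym a) (proj₁ tour i)
  ... | no i≢j with () ← ≡.trans (sym a) (≡.trans (proj₂ tour i j i≢j) (cong not b))

  double-arc : ∀ {i j} → i ≢ j → + 2 * arc M i j ≡ 1ℤ + sign M i j
  double-arc {i} {j} i≢j with entry M i j | entry M j i | proj₂ tour i j i≢j
  ... | true  | false | _ = refl
  ... | false | true  | _ = refl

  -- Off the diagonal twice an arc is 1 plus its sign; on the diagonal this identity fails, but
  -- disjointness makes the weight vanish there.
  double-count : ∀ (f g : Fin n → Bool) → (∀ i → f i ≡ true → g i ≡ true → ⊥) →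
    + 2 * (∑² λ x w → ⟦ f x ⟧ * ⟦ g w ⟧ * arc M x w) ≡
    ∑ (λ x → ⟦ f x ⟧) * ∑ (λ w → ⟦ g w ⟧) + discrepancy M (λ x → ⟦ f x ⟧) (λ w → ⟦ g w ⟧)
  double-count f g disjoint = begin
    + 2 * (∑² λ x w → F x w * arc M x w) ≡⟨ ≡.trans (*-∑ (+ 2) _) (∑-cong λ x → *-∑ (+ 2) _) ⟩
    (∑² λ x w → + 2 * (F x w * arc M x w)) ≡⟨ (∑-cong λ x → ∑-cong λ w → pointwise x w) ⟩
    (∑² λ x w → F x w + F x w * sign M x w) ≡⟨ ≡.trans (∑-cong λ x → ∑-+ _ _) (∑-+ _ _) ⟩
    (∑² λ x w → F x w) + discrepancy M (λ x → ⟦ f x ⟧) (λ w → ⟦ g w ⟧)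
      ≡⟨ cong (_+ discrepancy M (λ x → ⟦ f x ⟧) (λ w → ⟦ g w ⟧)) (sym (∑-product _ _)) ⟩
    ∑ (λ x → ⟦ f x ⟧) * ∑ (λ w → ⟦ g w ⟧) + discrepancy M (λ x → ⟦ f x ⟧) (λ w → ⟦ g w ⟧) ∎
    where
    open ≡-Reasoning
    F : Fin n → Fin n → ℤ
    F x w = ⟦ f x ⟧ * ⟦ g w ⟧
    F-diagonal : ∀ x → F x x ≡ 0ℤ
    F-diagonal x with f x | g x | disjoint x
    ... | true  | true  | d = ⊥-elim (d refl refl)
    ... | true  | false | _ = refl
    ... | false | true  | _ = refl
    ... | false | false | _ = refl
    pointwise : ∀ x w → + 2 * (F x w * arc M x w) ≡ F x w + F x w * sign M x w
    pointwise x w with x ≟ w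
    ... | yes refl rewrite F-diagonal x = refl
    ... | no x≢w = begin
      + 2 * (F x w * arc M x w)
        ≡⟨ solve 2 (λ F a → con (+ 2) :* (F :* a) := F :* (con (+ 2) :* a)) refl (F x w) (arc M x w) ⟩
      F x w * (+ 2 * arc M x w) ≡⟨ cong (_*_ (F x w)) (double-arc x≢w) ⟩
      F x w * (1ℤ + sign M x w) ≡⟨ solve 2 (λ F s → F :* (con 1ℤ :+ s) := F :+ F :* s) refl (F x w) (sign M x w) ⟩
      F x w + F x w * sign M x w ∎

no-three-colours : (a b c : Fin 2) → a ≢ b → b ≢ c → c ≢ a → ⊥
no-three-colours zero       zero       _          p _ _ = p refl
no-three-colours (suc zero) (suc zero) _          p _ _ = p refl
no-three-colours zero       (suc zero) zero       _ _ r = r refl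
no-three-colours zero       (suc zero) (suc zero) _ q _ = q refl
no-three-colours (suc zero) zero       zero       _ q _ = q refl
no-three-colours (suc zero) zero       (suc zero) _ _ r = r refl

-- At most two of `p`, `q`, `r` hold. If two do, a single summand survives; they force two of the
-- arcs, and the third arc is the factor of that summand.
triangle-bits : ∀ p q r a b c → (p ≡ true → a ≡ true) → (q ≡ true → c ≡ true) → (r ≡ true → b ≡ true) →
  (p ≡ true → q ≡ true → r ≡ true → ⊥) →
  ⟦ p ⟧ * ⟦ q ⟧ * ⟦ b ⟧ + (⟦ r ⟧ * ⟦ p ⟧ * ⟦ c ⟧ + ⟦ q ⟧ * ⟦ r ⟧ * ⟦ a ⟧) ≤ ⟦ a ⟧ * ⟦ c ⟧ * ⟦ b ⟧
triangle-bits true  true  true  a b c _ _ _ ¬pqr = ⊥-elim (¬pqr refl refl refl)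
triangle-bits true  true  false a b c pa qc _ _ rewrite pa refl | qc refl = ℤ.≤-reflexive (ℤ.+-identityʳ _)
triangle-bits true  false true  a true c pa _ _ _ rewrite pa refl = ℤ.≤-reflexive
  (solve 1 (λ c → con 0ℤ :+ (con 1ℤ :* c :+ con 0ℤ) := (con 1ℤ :* c) :* con 1ℤ) refl ⟦ c ⟧)
triangle-bits true  false true  a false c _ _ rb _ with () ← rb refl
triangle-bits false true  true  a true c _ qc _ _ rewrite qc refl = ℤ.≤-reflexive
  (solve 1 (λ a → con 0ℤ :+ (con 0ℤ :+ con 1ℤ :* a) := (a :* con 1ℤ) :* con 1ℤ) refl ⟦ a ⟧)
triangle-bits false true  true  a false c _ _ rb _ with () ← rb refl
triangle-bits false false true  a b c _ _ _ _ = 0≤* (0≤* (0≤⟦⟧ a) (0≤⟦⟧ c)) (0≤⟦⟧ b)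
triangle-bits false true  false a b c _ _ _ _ = 0≤* (0≤* (0≤⟦⟧ a) (0≤⟦⟧ c)) (0≤⟦⟧ b)
triangle-bits true  false false a b c _ _ _ _ = 0≤* (0≤* (0≤⟦⟧ a) (0≤⟦⟧ c)) (0≤⟦⟧ b)
triangle-bits false false false a b c _ _ _ _ = 0≤* (0≤* (0≤⟦⟧ a) (0≤⟦⟧ c)) (0≤⟦⟧ b)

-- The bound (n/K)⁴ on `fourCycles M` with denominators cleared. Together with `discrepancy⁴≤` it
-- bounds every discrepancy by n²/K.
FewFourCycles : ℕ → Matrix n → Set
FewFourCycles {n} K M = (+ K * + K) * (+ K * + K) * fourCycles M ≤ (+ n * + n) * (+ n * + n)

module _ {M : Matrix n} (K : ℕ)
  (few : FewFourCycles K M)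
  (f g : Fin n → ℤ) (∣f∣≤1 : ∀ i → ∣ f i ∣ ℕ.≤ 1) (∣g∣≤1 : ∀ i → ∣ g i ∣ ℕ.≤ 1) where
  private
    D = discrepancy M f g
    fourth : ((+ K * D) * (+ K * D)) * ((+ K * D) * (+ K * D)) ≤ ((+ n * + n) * (+ n * + n)) *
        ((+ n * + n) * (+ n * + n))
    fourth = begin
      ((+ K * D) * (+ K * D)) * ((+ K * D) * (+ K * D))
        ≡⟨ solve 2 (λ K D → ((K :* D) :* (K :* D)) :* ((K :* D) :* (K :* D)) := ((K :* K) :* (K :* K)) :*
            ((D :* D) :* (D :* D))) refl (+ K) D ⟩
      K⁴ * ((D * D) * (D * D)) ≤⟨ nonneg-mono 0≤K⁴ (discrepancy⁴≤ M f g ∣f∣≤1 ∣g∣≤1) ⟩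
      K⁴ * (n⁴ * fourCycles M) ≡⟨ solve 3 (λ K n Q → K :* (n :* Q) := n :* (K :* Q)) refl K⁴ n⁴ (fourCycles M) ⟩
      n⁴ * (K⁴ * fourCycles M) ≤⟨ nonneg-mono 0≤n⁴ few ⟩
      n⁴ * n⁴ ∎
      where
      open ℤ.≤-Reasoning
      K⁴ = (+ K * + K) * (+ K * + K)
      n⁴ = (+ n * + n) * (+ n * + n)
      0≤K⁴ : 0ℤ ≤ K⁴
      0≤K⁴ = 0≤-square (+ K * + K)
      0≤n⁴ : 0ℤ ≤ n⁴
      0≤n⁴ = 0≤-square (+ n * + n)

    square : (+ K * D) * (+ K * D) ≤ (+ n * + n) * (+ n * + n)
    square = square-cancel (0≤-square (+ n * + n)) fourth

  discrepancy≤ : + K * D ≤ + n * + n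
  discrepancy≤ = square-cancel (0≤-square (+ n)) square

  -discrepancy≤ : - (+ K * D) ≤ + n * + n
  -discrepancy≤ = square-cancel (0≤-square (+ n))
    (ℤ.≤-trans (ℤ.≤-reflexive (solve 1 (λ d → (:- d) :* (:- d) := d :* d) refl (+ K * D))) square)

-- Corners and cyclic triangles

∑³ : (Fin n → Fin n → Fin n → ℤ) → ℤ
∑³ F = ∑ λ v → ∑² (F v)

∑³-rotate : (F : Fin n → Fin n → Fin n → ℤ) → ∑³ (λ v x w → F x w v) ≡ ∑³ F
∑³-rotate F = ≡.trans (∑-swap _) (∑-cong λ x → ∑-swap _)

∑³-+ : (F G : Fin n → Fin n → Fin n → ℤ) → ∑³ (λ v x w → F v x w + G v x w) ≡ ∑³ F + ∑³ G
∑³-+ F G = ≡.trans (∑-cong λ v → ≡.trans (∑-cong λ x → ∑-+ _ _) (∑-+ _ _)) (∑-+ _ _)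

cube : ℕ → ℤ
cube n = + n * (+ n * + n)

module _ (M : Matrix n) (tour : IsTournament M) (c : Colouring n) where
  open Reach M c

  missed⇒arc : ∀ {v w} → missed v w ≡ true → Arc M w v
  missed⇒arc {v} {w} e = ≡.trans (proj₂ tour w v (¬r ∘ inj₁)) (cong not (¬-not (¬r ∘ inj₂ ∘ inj₁)))
    where
    ¬r : ¬ Reached v w
    ¬r = missed⇒¬Reached v w e

  missed⇒bichromatic : ∀ {v w x} → missed v w ≡ true → Arc M v x → Arc M x w → c v x ≢ c x w
  missed⇒bichromatic {v} {w} e a b same = missed⇒¬Reached v w e (inj₂ (inj₂ (_ , a , b , same)))

  -- The remaining arcs v → x and w → v of the cyclic triangle are implied by the two misses through
  -- `missed⇒arc`.
  corner : Fin n → Fin n → Fin n → ℤ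
  corner v x w = u x v * u v w * arc M x w

  triangle : Fin n → Fin n → Fin n → ℤ
  triangle v x w = arc M v x * arc M w v * arc M x w

  -- Each miss makes the two arcs of the opposite path differ in colour. Three misses around the
  -- triangle would demand three pairwise different colours.
  corners≤triangle : ∀ v x w → corner v x w + (corner x w v + corner w v x) ≤ triangle v x w
  corners≤triangle v x w = triangle-bits (missed x v) (missed v w) (missed w x) (entry M v x) (entry M x w)
      (entry M w v)
    missed⇒arc missed⇒arc missed⇒arc λ p q r → no-three-colours (c v x) (c x w) (c w v)
      (missed⇒bichromatic q (missed⇒arc p) (missed⇒arc r))
      (missed⇒bichromatic p (missed⇒arc r) (missed⇒arc q))
      (missed⇒bichromatic r (missed⇒arc q) (missed⇒arc p))

  -- Rotating the summation variables turns the three corner sums into one and the same sum.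
  3corners≤triangles : ∑³ corner + (∑³ corner + ∑³ corner) ≤ ∑³ triangle
  3corners≤triangles = begin
    ∑³ corner + (∑³ corner + ∑³ corner)
      ≡⟨ cong (_+_ (∑³ corner)) (cong₂ _+_ (∑³-rotate corner)
          (≡.trans (∑³-rotate (λ v x w → corner x w v)) (∑³-rotate corner))) ⟨
    ∑³ corner + (∑³ (λ v x w → corner x w v) + ∑³ (λ v x w → corner w v x))
      ≡⟨ ≡.trans (∑³-+ _ _) (cong (_+_ (∑³ corner)) (∑³-+ _ _)) ⟨
    ∑³ (λ v x w → corner v x w + (corner x w v + corner w v x))
      ≤⟨ (∑-mono λ v → ∑-mono λ x → ∑-mono λ w → corners≤triangle v x w) ⟩
    ∑³ triangle ∎
    where open ℤ.≤-Reasoning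

  missers missees outdegree indegree cornerError triangleError : Fin n → ℤ
  missers v       = ∑ λ x → u x v
  missees v       = ∑ λ w → u v w
  outdegree v     = ∑ λ x → arc M v x
  indegree v      = ∑ λ w → arc M w v
  cornerError v   = discrepancy M (λ x → u x v) (λ w → u v w)
  triangleError v = discrepancy M (λ x → arc M v x) (λ w → arc M w v)

  -- For fixed `v` the corners are the arcs from the missers of `v` to its missees. These sets are
  -- disjoint: missers are out-neighbours of `v`, missees are in-neighbours.
  2corners : + 2 * ∑³ corner ≡ ∑ (λ v → missers v * missees v) + ∑ cornerError
  2corners = ≡.trans (*-∑ (+ 2) _) (≡.trans (∑-cong λ v → double-count M tour (λ x → missed x v) (λ w → missed v w)
    λ x p q → arc-asym M tour v x (missed⇒arc {x} {v} p) (missed⇒arc {v} {x} q)) (∑-+ _ _))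

  2triangles : + 2 * ∑³ triangle ≡ ∑ (λ v → outdegree v * indegree v) + ∑ triangleError
  2triangles = ≡.trans (*-∑ (+ 2) _) (≡.trans (∑-cong λ v → double-count M tour (λ x → entry M v x)
      (λ w → entry M w v)
    λ x p q → arc-asym M tour v x p q) (∑-+ _ _))

  -- At each vertex 4pq ≤ (p + q)² ≤ n², as the out- and in-neighbourhoods are disjoint.
  degrees≤ : + 4 * ∑ (λ v → outdegree v * indegree v) ≤ cube n
  degrees≤ = ℤ.≤-trans (ℤ.≤-reflexive (*-∑ (+ 4) _)) (∑-bound λ v → begin
    + 4 * (outdegree v * indegree v)
      ≤⟨ ≤-by _ (0≤-square (outdegree v - indegree v))
           (solve 2 (λ p q → (p :+ q) :* (p :+ q) := con (+ 4) :* (p :* q) :+ (p :- q) :* (p :- q)) refl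
               (outdegree v) (indegree v)) ⟩
    (outdegree v + indegree v) * (outdegree v + indegree v)
      ≤⟨ square-mono (0≤+ (∑-nonneg λ x → 0≤⟦⟧ _) (∑-nonneg λ x → 0≤⟦⟧ _)) (degree-sum v) ⟩
    + n * + n ∎)
    where
    open ℤ.≤-Reasoning
    arcs≤1 : ∀ v x → arc M v x + arc M x v ≤ 1ℤ
    arcs≤1 v x with entry M v x in p | entry M x v in q
    ... | true  | true  = ⊥-elim (arc-asym M tour v x p q)
    ... | true  | false = ℤ.≤-refl
    ... | false | true  = ℤ.≤-refl
    ... | false | false = +≤+ ℕ.z≤n
    degree-sum : ∀ v → outdegree v + indegree v ≤ + n
    degree-sum v = begin
      outdegree v + indegree v ≡⟨ ∑-+ _ _ ⟨
      ∑ (λ x → arc M v x + arc M x v) ≤⟨ ∑-bound (arcs≤1 v) ⟩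
      + n * 1ℤ ≡⟨ ℤ.*-identityʳ (+ n) ⟩
      + n ∎

  module _ (many : ∀ v → + 5 * + n ≤ + 16 * missees v) where

    -- Misses counted from either end have the same total. So `many` applies twice: to the factor
    -- `missees v`, and, after the swap of sums, to the total of `missers`. This yields (5/16)²n³.
    misses≥ : + 25 * cube n ≤ + 256 * ∑ (λ v → missers v * missees v)
    misses≥ = begin
      + 25 * cube n
        ≡⟨ solve 1 (λ n → con (+ 25) :* (n :* (n :* n)) := (con (+ 5) :* n) :* (n :* (con (+ 5) :* n))) refl (+ n) ⟩
      m * (+ n * m) ≡⟨ cong (_*_ m) (∑-const n m) ⟨
      m * ∑ {n} (λ _ → m) ≤⟨ m-mono (∑-mono many) ⟩
      m * ∑ (λ v → + 16 * missees v) ≡⟨ cong (_*_ m) (≡.trans (sym (*-∑ (+ 16) _)) (cong (_*_ (+ 16)) (∑-swap _))) ⟩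
      m * (+ 16 * ∑ missers)
        ≡⟨ solve 2 (λ m a → m :* (con (+ 16) :* a) := con (+ 16) :* (a :* m)) refl m (∑ missers) ⟩
      + 16 * (∑ missers * m) ≡⟨ cong (_*_ (+ 16)) (∑-* missers m) ⟩
      + 16 * ∑ (λ v → missers v * m) ≤⟨ ℤ.*-monoˡ-≤-nonNeg (+ 16) (∑-mono λ v → missers-mono v (many v)) ⟩
      + 16 * ∑ (λ v → missers v * (+ 16 * missees v))
        ≡⟨ cong (_*_ (+ 16)) (≡.trans (∑-cong λ v → solve 2
            (λ a b → a :* (con (+ 16) :* b) := con (+ 16) :* (a :* b)) refl (missers v) (missees v))
            (sym (*-∑ (+ 16) _))) ⟩
      + 16 * (+ 16 * ∑ (λ v → missers v * missees v))
        ≡⟨ solve 1 (λ a → con (+ 16) :* (con (+ 16) :* a) := con (+ 256) :* a) refl (∑ λ v → missers v * missees v) ⟩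
      + 256 * ∑ (λ v → missers v * missees v) ∎
      where
      open ℤ.≤-Reasoning
      m = + 5 * + n
      m-mono : ∀ {j k} → j ≤ k → m * j ≤ m * k
      m-mono = nonneg-mono (0≤* {+ 5} {+ n} (+≤+ ℕ.z≤n) (+≤+ ℕ.z≤n))
      missers-mono : ∀ v {j k} → j ≤ k → missers v * j ≤ missers v * k
      missers-mono v = nonneg-mono (∑-nonneg λ x → 0≤⟦⟧ (missed x v))

    module _ (few : FewFourCycles 128 M) where

      cornerError≥ : 0ℤ ≤ cube n + + 128 * ∑ cornerError
      cornerError≥ = ℤ.≤-trans (∑-nonneg λ v → ℤ.≤-trans
          (ℤ.i≤j⇒0≤j-i (-discrepancy≤ {M = M} 128 few (λ x → u x v) (λ w → u v w)
          (λ x → ∣⟦⟧∣≤1 (missed x v)) (λ w → ∣⟦⟧∣≤1 (missed v w))))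
            (ℤ.≤-reflexive (cong (_+_ (+ n * + n)) (ℤ.neg-involutive (+ 128 * cornerError v)))))
        (ℤ.≤-reflexive (≡.trans (∑-+ _ _) (cong₂ _+_ (∑-const n _) (sym (*-∑ (+ 128) _)))))

      triangleError≤ : + 128 * ∑ triangleError ≤ cube n
      triangleError≤ = ℤ.≤-trans (ℤ.≤-reflexive (*-∑ (+ 128) _)) (∑-bound λ v →
        discrepancy≤ {M = M} 128 few (λ x → arc M v x) (λ w → arc M w v) (λ x → ∣⟦⟧∣≤1 (entry M v x))
            (λ w → ∣⟦⟧∣≤1 (entry M w v)))

      -- Up to errors, (25/256)n³ ≤ 2·corners ≤ (2/3)·triangles ≤ n³/12. Over the denominator 768
      -- this reads 75 ≤ 64; the corner and triangle errors account for at most 6 and 2, so a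
      -- contradictory surplus of 3 remains.
      cube≤0 : cube n ≤ 0ℤ
      cube≤0 = ℤ.*-cancelˡ-≤-pos (cube n) 0ℤ (+ 3) (≤-by _
        (0≤+ (0≤* {+ 3} (+≤+ ℕ.z≤n) (ℤ.i≤j⇒0≤j-i misses≥))
        (0≤+ (0≤* {+ 512} (+≤+ ℕ.z≤n) (ℤ.i≤j⇒0≤j-i 3corners≤triangles))
        (0≤+ (0≤* {+ 64} (+≤+ ℕ.z≤n) (ℤ.i≤j⇒0≤j-i degrees≤))
        (0≤+ (0≤* {+ 2} (+≤+ ℕ.z≤n) (ℤ.i≤j⇒0≤j-i triangleError≤))
             (0≤* {+ 6} (+≤+ ℕ.z≤n) cornerError≥)))))
        (combine (cube n) (∑³ corner) (∑³ triangle) (∑ λ v → missers v * missees v) (∑ cornerError)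
            (∑ λ v → outdegree v * indegree v) (∑ triangleError) 2corners 2triangles))
        where
        -- The multipliers cancel E, T, D and D′; an error bound of n²/128 is just small enough to
        -- leave the coefficient −3 of N in the remaining terms.
        combine : ∀ N E T AB D PQ D′ → + 2 * E ≡ AB + D → + 2 * T ≡ PQ + D′ →
          0ℤ ≡ + 3 * N + (+ 3 * (+ 256 * AB - + 25 * N) + (+ 512 * (T - (E + (E + E)))
            + (+ 64 * (N - + 4 * PQ) + (+ 2 * (N - + 128 * D′) + + 6 * (N + + 128 * D)))))
        combine N E T AB D PQ D′ eE eT = ≡.trans
          (solve 5 (λ N E T D D′ → con 0ℤ := con (+ 3) :* N :+
              (con (+ 3) :* (con (+ 256) :* (con (+ 2) :* E :- D) :- con (+ 25) :* N)
            :+ (con (+ 512) :* (T :- (E :+ (E :+ E))) :+ (con (+ 64) :* (N :- con (+ 4) :* (con (+ 2) :* T :- D′))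
            :+ (con (+ 2) :* (N :- con (+ 128) :* D′) :+ con (+ 6) :* (N :+ con (+ 128) :* D)))))) refl N E T D D′)
          (cong₂ (λ AB PQ → + 3 * N + (+ 3 * (+ 256 * AB - + 25 * N) + (+ 512 * (T - (E + (E + E)))
            + (+ 64 * (N - + 4 * PQ) + (+ 2 * (N - + 128 * D′) + + 6 * (N + + 128 * D)))))) (solve-for AB D eE)
                (solve-for PQ D′ eT))
          where
          solve-for : ∀ {s} a d → s ≡ a + d → s - d ≡ a
          solve-for a d refl = solve 2 (λ a d → a :+ d :- d := a) refl a d

-- All roots are searched. If none reaches `m` vertices, every vertex misses at least 5n/16 others,
-- and `cube≤0` contradicts 0 < n.
lower-deterministic : ∀ {M : Matrix n} → IsTournament M → 0 ℕ.< n →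
  FewFourCycles 128 M →
  Guarantees M (n ℕ.∸ (5 ℕ.* n) / 16)
lower-deterministic {n} {M} tour 0<n few c = decide (any? λ v → m ℕ.≤? Subset.∣ reachedSet v ∣)
  where
  open Reach M c
  q = (5 ℕ.* n) / 16
  m = n ℕ.∸ q
  Large : Set
  Large = ∃ λ v → m ℕ.≤ Subset.∣ reachedSet v ∣
  0<cube : ∀ {n} → 0 ℕ.< n → 0ℤ < cube n
  0<cube {suc n} _ = ℤ.positive⁻¹ (cube (suc n))
  q≤n : q ℕ.≤ n
  q≤n = ℕ.*-cancelʳ-≤ q n 16 (ℕ.≤-trans (m/n*n≤m (5 ℕ.* n) 16)
    (ℕ.≤-trans (ℕ.*-monoˡ-≤ n (ℕ.m≤m+n 5 11)) (ℕ.≤-reflexive (ℕ.*-comm 16 n))))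
  5n≤ : 5 ℕ.* n ℕ.≤ 16 ℕ.* suc q
  5n≤ = begin
    5 ℕ.* n                                 ≡⟨ m≡m%n+[m/n]*n (5 ℕ.* n) 16 ⟩
    (5 ℕ.* n) % 16 ℕ.+ q ℕ.* 16             ≤⟨ ℕ.+-monoˡ-≤ (q ℕ.* 16) (ℕ.<⇒≤ (m%n<n (5 ℕ.* n) 16)) ⟩
    16 ℕ.+ q ℕ.* 16                         ≡⟨ ℕ.*-comm (suc q) 16 ⟩
    16 ℕ.* suc q                            ∎
    where open ℕ.≤-Reasoning
  -- Reaching fewer than n - q vertices means missing at least q + 1, and q + 1 ≥ 5n/16 although `q`
  -- itself is rounded down.
  many : ¬ Large → ∀ v → + 5 * + n ≤ + 16 * missees M tour c v
  many ¬large v = begin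
    + 5 * + n                   ≡⟨ ℤ.pos-* 5 n ⟨
    + (5 ℕ.* n)                 ≤⟨ +≤+ 5n≤ ⟩
    + (16 ℕ.* suc q)            ≡⟨ ℤ.pos-* 16 (suc q) ⟩
    + 16 * + suc q
      ≤⟨ ℤ.*-monoˡ-≤-nonNeg (+ 16) (≤-by {+ suc q} (+ (n ℕ.∸ (r ℕ.+ suc q))) (+≤+ ℕ.z≤n) split) ⟩
    + 16 * missees M tour c v     ∎
    where
    open ℤ.≤-Reasoning
    r = Subset.∣ reachedSet v ∣
    r+q<n : r ℕ.+ suc q ℕ.≤ n
    r+q<n = subst (ℕ._≤ n) (sym (ℕ.+-suc r q)) (ℕ.m≤o∸n⇒m+n≤o (suc r) q≤n (ℕ.≰⇒> λ m≤ → ¬large (v , m≤)))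
    split : missees M tour c v ≡ + suc q + + (n ℕ.∸ (r ℕ.+ suc q))
    split = ∙-cancelˡ ℤ.+-0-abelianGroup (+ r) _ _ (≡.trans (reached+missed v)
        (sym (≡.trans (sym (ℤ.+-assoc (+ r) (+ suc q) (+ (n ℕ.∸ (r ℕ.+ suc q)))))
      (cong +_ (ℕ.m+[n∸m]≡n r+q<n)))))
  decide : Dec Large → Σ (PMArb2 M c) λ A → m ℕ.≤ Subset.∣ PMArb2.verts A ∣
  decide (yes (v , m≤)) = arborescence v , m≤
  decide (no ¬large)    = ⊥-elim (ℤ.<⇒≱ (0<cube 0<n) (cube≤0 M tour c (many ¬large) few))

-- Asymptotics

-- Where `P` fails, `X` is at least `t`, so by Markov the failures make up at most a fraction b/t ≤
-- 1/(k + 1) of all tournaments.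
probAtMost : ∀ (P : Matrix n → Set) (X : Matrix n → ℤ) {b t} k → (∀ M → 0ℤ ≤ X M) → 𝔼 X ≤ b * #tournaments n →
  0ℤ < t → + suc k * b ≤ t → (∀ M → IsTournament M → X M < t → P M) → ProbAtMost n (λ M → ¬ P M) k
probAtMost {n} P X {b} {t} k 0≤X 𝔼X≤ 0<t kb≤t below L uL all = subst (suc k ℕ.* length L ℕ.≤_) (length-tournaments n)
  (ℤ.drop‿+≤+ (subst (_≤ N) (sym (ℤ.pos-* (suc k) (length L)))
      (ℤ.*-cancelʳ-≤-pos (+ suc k * ℓ) N t {{positive 0<t}} (begin
    + suc k * ℓ * t     ≡⟨ ℤ.*-assoc (+ suc k) ℓ t ⟩
    + suc k * (ℓ * t)   ≤⟨ ℤ.*-monoˡ-≤-nonNeg (+ suc k) (markov {n} {X} 0≤X 𝔼X≤ uL (All.map large all)) ⟩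
    + suc k * (b * N)   ≡⟨ ℤ.*-assoc (+ suc k) b N ⟨
    + suc k * b * N     ≤⟨ ℤ.*-monoʳ-≤-nonNeg N kb≤t ⟩
    t * N               ≡⟨ ℤ.*-comm t N ⟩
    N * t               ∎))))
  where
  open ℤ.≤-Reasoning
  N = #tournaments n
  ℓ = + length L
  large : ∀ {M} → IsTournament M × ¬ P M → IsTournament M × t ≤ X M
  large {M} (tour , ¬p) = tour , ℤ.≮⇒≥ (¬p ∘ below M tour)

-- The expected value of K⁴·`fourCycles` is at most 2K⁴n³ against the threshold n⁴, so n ≥ (k +
-- 1)·2K⁴ suffices for the ratio. The outer `suc` keeps n, and with it the threshold, positive.
fewFourCycles-whp : ∀ K k n → suc (suc k ℕ.* (2 ℕ.* (K ℕ.* K ℕ.* (K ℕ.* K)))) ℕ.≤ n → (P : Matrix n → Set) →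
  (∀ M → IsTournament M → FewFourCycles K M → P M) →
  ProbAtMost n (λ M → ¬ P M) k
fewFourCycles-whp K k n N<n P few⇒P = probAtMost P (λ M → K⁴ * fourCycles M) {K⁴ * (+ n * (+ n * (+ n * + 2)))} {n⁴} k
  (λ M → 0≤* 0≤K⁴ (0≤fourCycles M)) 𝔼≤ 0<n⁴ large λ M tour → few⇒P M tour ∘ ℤ.<⇒≤
  where
  open ℤ.≤-Reasoning
  K⁴ = (+ K * + K) * (+ K * + K)
  n⁴ = (+ n * + n) * (+ n * + n)
  0≤K⁴ : 0ℤ ≤ K⁴
  0≤K⁴ = 0≤-square (+ K * + K)
  0<fourth : ∀ {n} → 0 ℕ.< n → 0ℤ < (+ n * + n) * (+ n * + n)
  0<fourth {suc n} _ = ℤ.positive⁻¹ ((+ suc n * + suc n) * (+ suc n * + suc n))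
  0<n⁴ : 0ℤ < n⁴
  0<n⁴ = 0<fourth (ℕ.≤-trans (ℕ.s≤s ℕ.z≤n) N<n)
  𝔼≤ : 𝔼 {n} (λ M → K⁴ * fourCycles M) ≤ K⁴ * (+ n * (+ n * (+ n * + 2))) * #tournaments n
  𝔼≤ = begin
    𝔼 {n} (λ M → K⁴ * fourCycles M)  ≡⟨ ∑ᴸ-* K⁴ fourCycles (tournaments n) ⟩
    K⁴ * 𝔼 {n} fourCycles        ≤⟨ nonneg-mono 0≤K⁴ (𝔼-fourCycles {n}) ⟩
    K⁴ * (+ n * (+ n * (+ n * (+ 2 * #tournaments n))))
      ≡⟨ solve 3 (λ K n N → K :* (n :* (n :* (n :* (con (+ 2) :* N)))) := K :*
          (n :* (n :* (n :* con (+ 2)))) :* N) refl K⁴ (+ n) (#tournaments n) ⟩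
    K⁴ * (+ n * (+ n * (+ n * + 2))) * #tournaments n ∎
  large : + suc k * (K⁴ * (+ n * (+ n * (+ n * + 2)))) ≤ n⁴
  large = begin
    + suc k * (K⁴ * (+ n * (+ n * (+ n * + 2))))
      ≡⟨ solve 3 (λ k K n → k :* (K :* (n :* (n :* (n :* con (+ 2))))) := (n :* (n :* n)) :*
          (k :* (con (+ 2) :* K))) refl (+ suc k) K⁴ (+ n) ⟩
    cube n * (+ suc k * (+ 2 * K⁴))
      ≡⟨ cong (_*_ (cube n)) (≡.trans (ℤ.pos-* (suc k) _)
          (cong (_*_ (+ suc k)) (≡.trans (ℤ.pos-* 2 (K ℕ.* K ℕ.* (K ℕ.* K)))
           (cong (_*_ (+ 2)) (≡.trans (ℤ.pos-* (K ℕ.* K) (K ℕ.* K)) (cong₂ _*_ (ℤ.pos-* K K) (ℤ.pos-* K K))))))) ⟨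
    cube n * + (suc k ℕ.* (2 ℕ.* (K ℕ.* K ℕ.* (K ℕ.* K))))
      ≤⟨ nonneg-mono (0≤* {+ n} (+≤+ ℕ.z≤n) (0≤-square (+ n))) (+≤+ (ℕ.<⇒≤ N<n)) ⟩
    cube n * + n ≡⟨ solve 1 (λ n → (n :* (n :* n)) :* n := (n :* n) :* (n :* n)) refl (+ n) ⟩
    n⁴ ∎

-- At least 11n/16 vertices are reached, and 16·49 = 784 < 792 = 72·11. This constant gain over
-- 49/72 allows the error term 0.
lower-size : ∀ n → 49 ℕ.* n ℕ.≤ 72 ℕ.* (n ℕ.∸ (5 ℕ.* n) / 16 ℕ.+ 0)
lower-size n = ℕ.*-cancelˡ-≤ 16 (begin
  16 ℕ.* (49 ℕ.* n)       ≡⟨ ℕ.*-assoc 16 49 n ⟨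
  784 ℕ.* n               ≤⟨ ℕ.*-monoˡ-≤ n (ℕ.m≤m+n 784 8) ⟩
  792 ℕ.* n               ≡⟨ ℕ.*-assoc 72 11 n ⟩
  72 ℕ.* (11 ℕ.* n)       ≤⟨ ℕ.*-monoʳ-≤ 72 11n≤ ⟩
  72 ℕ.* (16 ℕ.* m)       ≡⟨ ℕ-solve 1 (λ m → ℕ-con 72 ⊗ (ℕ-con 16 ⊗ m) ⊜ ℕ-con 16 ⊗ (ℕ-con 72 ⊗ m)) refl m ⟩
  16 ℕ.* (72 ℕ.* m)       ≡⟨ cong (λ z → 16 ℕ.* (72 ℕ.* z)) (ℕ.+-identityʳ m) ⟨
  16 ℕ.* (72 ℕ.* (m ℕ.+ 0)) ∎)
  where
  open ℕ.≤-Reasoning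
  q = (5 ℕ.* n) / 16
  m = n ℕ.∸ q
  11n≤ : 11 ℕ.* n ℕ.≤ 16 ℕ.* m
  11n≤ = begin
    11 ℕ.* n                    ≡⟨ ℕ.*-distribʳ-∸ n 16 5 ⟩
    16 ℕ.* n ℕ.∸ 5 ℕ.* n        ≤⟨ ℕ.∸-monoʳ-≤ (16 ℕ.* n) (m/n*n≤m (5 ℕ.* n) 16) ⟩
    16 ℕ.* n ℕ.∸ q ℕ.* 16       ≡⟨ cong (16 ℕ.* n ℕ.∸_) (ℕ.*-comm q 16) ⟩
    16 ℕ.* n ℕ.∸ 16 ℕ.* q       ≡⟨ ℕ.*-distribˡ-∸ 16 n q ⟨
    16 ℕ.* m                    ∎

lower-from-fewFourCycles : ∀ K →
  (∀ {n} {M : Matrix n} → IsTournament M → 0 ℕ.< n → FewFourCycles K M → Guarantees M (n ℕ.∸ (5 ℕ.* n) / 16)) →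
  WithHighProb (LowerEvent λ _ → 0)
lower-from-fewFourCycles K guarantees k =
  _ , λ n N≤n → fewFourCycles-whp K k n N≤n (LowerEvent (λ _ → 0) n) λ M tour few →
  (n ℕ.∸ (5 ℕ.* n) / 16) , guarantees {M = M} tour (ℕ.≤-trans (ℕ.s≤s ℕ.z≤n) N≤n) few , lower-size n

lower : WithHighProb (LowerEvent λ _ → 0)
lower = lower-from-fewFourCycles 128 λ {n} {M} → lower-deterministic {n} {M}

fifthRoot : ∀ n → ∃ λ g → g ℕ.^ 5 ℕ.≤ n × n ℕ.< suc g ℕ.^ 5
fifthRoot zero    = 0 , ℕ.z≤n , ℕ.s≤s ℕ.z≤n
fifthRoot (suc n) with g , g⁵≤n , n<[1+g]⁵ ← fifthRoot n with suc g ℕ.^ 5 ℕ.≤? suc n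
... | yes ≤n = suc g , ≤n , ℕ.≤-<-trans n<[1+g]⁵ (ℕ.^-monoˡ-< 5 (ℕ.n<1+n (suc g)))
... | no ≰n  = g , ℕ.m≤n⇒m≤1+n g⁵≤n , ℕ.≰⇒> ≰n

⌊⁵√_⌋ : ℕ → ℕ
⌊⁵√ n ⌋ = proj₁ (fifthRoot n)

root-lower : ∀ {K n} → K ℕ.^ 5 ℕ.≤ n → K ℕ.≤ ⌊⁵√ n ⌋
root-lower {K} {n} K⁵≤n = ℕ.≮⇒≥ λ g<K → ℕ.<⇒≱ (proj₂ (proj₂ (fifthRoot n))) (ℕ.≤-trans (ℕ.^-monoˡ-≤ 5 g<K) K⁵≤n)

-- With h = ⌊n^(1/5)⌋ + 1 this error h⁴ is o(n), while its fourth power h¹⁶ still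
-- beats the bound 3n³ < 3h¹⁵ on the fourth moment.
upper-error : ℕ → ℕ
upper-error n = suc ⌊⁵√ n ⌋ ℕ.^ 4

upper-error-littleO : LittleO upper-error
-- From this threshold on g ≥ 16(k + 1), whence (k + 1)(g + 1)⁴ ≤ (k + 1)(2g)⁴ ≤ g⁵ ≤ n.
upper-error-littleO k = (16 ℕ.* suc k) ℕ.^ 5 , λ n N≤n → bound n (⌊⁵√ n ⌋) (root-lower N≤n)
  (proj₁ (proj₂ (fifthRoot n)))
  where
  open ℕ.≤-Reasoning
  bound : ∀ n g → 16 ℕ.* suc k ℕ.≤ g → g ℕ.^ 5 ℕ.≤ n → suc k ℕ.* suc g ℕ.^ 4 ℕ.≤ n
  bound n g large g⁵≤n = begin
    suc k ℕ.* suc g ℕ.^ 4           ≤⟨ ℕ.*-monoʳ-≤ (suc k) (ℕ.^-monoˡ-≤ 4 1+g≤2g) ⟩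
    suc k ℕ.* (2 ℕ.* g) ℕ.^ 4
      ≡⟨ ℕ-solve 2 (λ k g → k ⊗ (ℕ-con 2 ⊗ g) ↑ 4 ⊜ (ℕ-con 16 ⊗ k) ⊗ g ↑ 4) refl (suc k) g ⟩
    16 ℕ.* suc k ℕ.* g ℕ.^ 4        ≤⟨ ℕ.*-monoˡ-≤ (g ℕ.^ 4) large ⟩
    g ℕ.^ 5                         ≤⟨ g⁵≤n ⟩
    n                               ∎
    where
    1+g≤2g : suc g ℕ.≤ 2 ℕ.* g
    1+g≤2g = ℕ.+-mono-≤ {1} {g} (ℕ.≤-trans (ℕ.s≤s ℕ.z≤n) large) (ℕ.≤-reflexive (sym (ℕ.+-identityʳ g)))

upper : WithHighProb (UpperEvent upper-error)
-- The threshold gives k + 1 ≤ h for h = g + 1. With n ≤ h⁵ this yields (k + 1)·3n³ ≤ 3h¹⁶ ≤ 16h¹⁶ =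
-- (2h⁴)⁴, the fourth power of `E`.
upper k = suc k ℕ.^ 5 , λ n N≤n → let e = upper-error n ; E = 2 ℕ.* e in
  probAtMost (UpperEvent upper-error n) (quartic {n}) {+ n * (+ 3 * (+ n * + n))} {+ E * (+ E * (+ E * + E))} k
      (0≤quartic {n})
    (ℤ.≤-trans (𝔼-quartic {n}) (ℤ.≤-reflexive (solve 2 (λ n N → n :* (con (+ 3) :* (n :* (n :* N))) := n :*
        (con (+ 3) :* (n :* n)) :* N) refl (+ n) (#tournaments n))))
    (0<fourth (ℕ.≤-trans (ℕ.m^n>0 (suc ⌊⁵√ n ⌋) 4) (ℕ.m≤n*m e 2)))
    (subst₂ _≤_ (≡.trans (ℤ.pos-* (suc k) _) (cong (_*_ (+ suc k)) (pos-*⁴ n 3 n n))) (pos-*⁴ E E E E)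
      (+≤+ (bound n ⌊⁵√ n ⌋ (ℕ.m≤n⇒m≤1+n (root-lower N≤n)) (ℕ.<⇒≤ (proj₂ (proj₂ (fifthRoot n)))))))
    λ M tour small → upper-deterministic {n} {M} e tour small
  where
  pos-*⁴ : ∀ a b c d → + (a ℕ.* (b ℕ.* (c ℕ.* d))) ≡ + a * (+ b * (+ c * + d))
  pos-*⁴ a b c d = ≡.trans (ℤ.pos-* a _) (cong (_*_ (+ a)) (≡.trans (ℤ.pos-* b _) (cong (_*_ (+ b)) (ℤ.pos-* c d))))
  0<fourth : ∀ {n} → 0 ℕ.< n → 0ℤ < + n * (+ n * (+ n * + n))
  0<fourth {suc n} _ = ℤ.positive⁻¹ (+ suc n * (+ suc n * (+ suc n * + suc n)))
  bound : ∀ n g → suc k ℕ.≤ suc g → n ℕ.≤ suc g ℕ.^ 5 →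
    suc k ℕ.* (n ℕ.* (3 ℕ.* (n ℕ.* n))) ℕ.≤
    2 ℕ.* suc g ℕ.^ 4 ℕ.* (2 ℕ.* suc g ℕ.^ 4 ℕ.* (2 ℕ.* suc g ℕ.^ 4 ℕ.* (2 ℕ.* suc g ℕ.^ 4)))
  bound n g k≤g n≤ = begin
    suc k ℕ.* (n ℕ.* (3 ℕ.* (n ℕ.* n)))   ≤⟨ ℕ.*-mono-≤ k≤g (ℕ.*-mono-≤ n≤ (ℕ.*-monoʳ-≤ 3 (ℕ.*-mono-≤ n≤ n≤))) ⟩
    h ℕ.* (h ℕ.^ 5 ℕ.* (3 ℕ.* (h ℕ.^ 5 ℕ.* h ℕ.^ 5)))
      ≡⟨ ℕ-solve 1 (λ h → h ⊗ (h ↑ 5 ⊗ (ℕ-con 3 ⊗ (h ↑ 5 ⊗ h ↑ 5))) ⊜ ℕ-con 3 ⊗ h ↑ 16) refl h ⟩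
    3 ℕ.* h ℕ.^ 16                        ≤⟨ ℕ.*-monoˡ-≤ (h ℕ.^ 16) (ℕ.m≤m+n 3 13) ⟩
    16 ℕ.* h ℕ.^ 16
      ≡⟨ ℕ-solve 1 (λ h → ℕ-con 16 ⊗ h ↑ 16 ⊜ ℕ-con 2 ⊗ h ↑ 4 ⊗
          (ℕ-con 2 ⊗ h ↑ 4 ⊗ (ℕ-con 2 ⊗ h ↑ 4 ⊗ (ℕ-con 2 ⊗ h ↑ 4)))) refl h ⟩
    2 ℕ.* h ℕ.^ 4 ℕ.* (2 ℕ.* h ℕ.^ 4 ℕ.* (2 ℕ.* h ℕ.^ 4 ℕ.* (2 ℕ.* h ℕ.^ 4))) ∎
    where
    open ℕ.≤-Reasoning
    h = suc g

theorem3 : (∃ λ (ε : ℕ → ℕ) → LittleO ε × WithHighProb (LowerEvent ε))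
    × (∃ λ (ε : ℕ → ℕ) → LittleO ε × WithHighProb (UpperEvent ε))
theorem3 = ((λ _ → 0) , (λ k → 0 , λ n _ → subst (ℕ._≤ n) (sym (ℕ.*-zeroʳ (suc k))) ℕ.z≤n) , lower)
         , (upper-error , upper-error-littleO , upper)
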